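{- Let $A$ be an uncountable abelian Polish group. Then at least one of the following holds: (1) $\ell^1(\mathbb Z)\sqsubseteq^{\mathbb Z}A$; (2) $(\mathbb Z/p\mathbb Z)^{\mathbb N}\sqsubseteq^{\mathbb Z}A$ for some prime $p$.
   Context: $\mathbb Z$ carries the usual absolute value (a proper norm) and the discrete topology; abelian Polish groups are Polish $\mathbb Z$-modules. $M\sqsubseteq^{\mathbb Z}N$ means there is a continuous group homomorphism $M\to N$ which is injective. $\ell^1(\mathbb Z)=\{(n_k)_{k\in\mathbb N}\in\mathbb Z^{\mathbb N}:\sum_k|n_k|/k!<\infty\}$ with the norm $\sum_k|n_k|/k!$ (and associated metric topology). $(\mathbb Z/p\mathbb Z)^{\mathbb N}$ has the product topology. -}

module Defs where

open import Algebra.Bundles using (AbelianGroup)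
import Algebra.Construct.Pointwise as Pointwise
open import Algebra.Morphism.Structures using (module GroupMorphisms)
open import Data.Integer.Base as ℤ using (ℤ; ∣_∣)
import Data.Integer.Properties as ℤ
open import Data.Integer.Divisibility.Signed using (∣m∣n⇒∣m+n; ∣m⇒∣-m; divides)
  renaming (_∣_ to _∣ℤ_)
open import Data.Integer.Solver using (module +-*-Solver)
open import Data.Nat.Base as ℕ using (ℕ; zero; suc; _!)
import Data.Nat.Properties as ℕ
open import Data.Product.Base using (∃; ∃₂; Σ; _×_; _,_; proj₁; proj₂)
open import Data.Rational.Base as ℚ using (ℚ; 0ℚ; ½; _<_; _≤_; _+_; _-_; -_; _/_)
import Data.Rational.Properties as ℚ
import Data.Rational.Unnormalised.Base as ℚᵘ
import Data.Rational.Unnormalised.Properties as ℚᵘ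
open import Data.Sum.Base using (inj₁; inj₂)
open import Data.Unit.Base using (⊤; tt)
open import Function.Bundles using (Injection; _⇔_)
open import Function.Metric.Core using (DistanceFunction)
open import Function.Metric.Structures using (IsGeneralMetric)
open import Level using (Level; 0ℓ; _⊔_) renaming (suc to lsuc)
open import Relation.Binary.Bundles using (Setoid)
open import Relation.Binary.Core using (Rel)
open import Relation.Binary.Definitions using (_Respects_; tri<; tri≈; tri>)
open import Relation.Binary.PropositionalEquality as ≡
  using (_≡_; refl; sym; trans; cong; cong₂; subst)
open import Relation.Binary.Structures using (IsPartialOrder)
open import Relation.Nullary using (yes; no)
open import Relation.Nullary.Negation using (¬_; contradiction)
open import Relation.Unary using (Pred; _⊆_; _≐_; _∩_; ⋃)

private
  variable
    c c′ ℓ ℓ′ o o′ : Level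

-- A real number x is given by the set { q ∈ ℚ ∣ x < q }, i.e. by the upper
-- half of a Dedekind cut.  No locatedness is required: in the presence of
-- excluded middle it is automatic, so these are the classical reals.

record ℝ : Set₁ where
  infix 4 _<ℚ_
  field
    _<ℚ_      : Pred ℚ 0ℓ
    inhabited : ∃ λ q → _<ℚ_ q
    bounded   : ∃ λ q → ¬ _<ℚ_ q
    upward    : ∀ {q r} → q < r → _<ℚ_ q → _<ℚ_ r
    rounded   : ∀ {r} → _<ℚ_ r → ∃ λ q → q < r × _<ℚ_ q

open ℝ public using (_<ℚ_)

infix 4 _≤ᴿ_ _≈ᴿ_
infixl 6 _+ᴿ_

_≤ᴿ_ : Rel ℝ 0ℓ
x ≤ᴿ y = ∀ {q} → y <ℚ q → x <ℚ q

_≈ᴿ_ : Rel ℝ 0ℓ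
x ≈ᴿ y = x ≤ᴿ y × y ≤ᴿ x

p+[q-p]≡q : ∀ p q → p + (q - p) ≡ q
p+[q-p]≡q p q = begin
  p + (q - p)   ≡⟨ ℚ.+-comm p (q - p) ⟩
  (q - p) + p   ≡⟨ ℚ.+-assoc q (- p) p ⟩
  q + (- p + p) ≡⟨ cong (q +_) (ℚ.+-inverseˡ p) ⟩
  q + 0ℚ        ≡⟨ ℚ.+-identityʳ q ⟩
  q             ∎
  where open ≡.≡-Reasoning

p<q⇒0<q-p : ∀ {p q} → p < q → 0ℚ < q - p
p<q⇒0<q-p {p} {q} p<q =
  subst (_< q - p) (ℚ.+-inverseʳ p) (ℚ.+-monoˡ-< (- p) p<q)

halves : ∀ ε → ε ℚ.* ½ + ε ℚ.* ½ ≡ ε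
halves ε = trans (sym (ℚ.*-distribˡ-+ ε ½ ½)) (ℚ.*-identityʳ ε)

half>0 : ∀ {ε} → 0ℚ < ε → 0ℚ < ε ℚ.* ½
half>0 {ε} 0<ε = subst (_< ε ℚ.* ½) (ℚ.*-zeroˡ ½) (ℚ.*-monoˡ-<-pos ½ 0<ε)

between : ∀ {p q} → p < q → ∃ λ r → p < r × r < q
between p<q = let r , p<r , r<q = ℚ.<-dense p<q in r , p<r , r<q

0ᴿ : ℝ
0ᴿ = record
  { _<ℚ_      = 0ℚ <_
  ; inhabited = ℚ.1ℚ , ℚ.positive⁻¹ ℚ.1ℚ
  ; bounded   = 0ℚ , ℚ.<-irrefl refl
  ; upward    = λ q<r 0<q → ℚ.<-trans 0<q q<r
  ; rounded   = λ 0<r → let q , 0<q , q<r = between 0<r in q , q<r , 0<q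
  }

_+ᴿ_ : ℝ → ℝ → ℝ
x +ᴿ y = record
  { _<ℚ_      = λ q → ∃₂ λ a b → x <ℚ a × y <ℚ b × a + b ≡ q
  ; inhabited = _ , proj₁ x.inhabited , proj₁ y.inhabited ,
                proj₂ x.inhabited , proj₂ y.inhabited , refl
  ; bounded   = proj₁ x.bounded + proj₁ y.bounded ,
                λ (a , b , x<a , y<b , eq) → ℚ.<-irrefl (sym eq)
                  (ℚ.+-mono-< (above x x<a) (above y y<b))
  ; upward    = λ { {q} {r} q<r (a , b , x<a , y<b , refl) →
                  a , r - a , x<a ,
                  y.upward (shift a b q<r) y<b , p+[q-p]≡q a r }
  ; rounded   = λ { (a , b , x<a , y<b , refl) →
                  let a′ , a′<a , x<a′ = x.rounded x<a in
                  a′ + b , ℚ.+-monoˡ-< b a′<a , a′ , b , x<a′ , y<b , refl }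
  }
  where
  module x = ℝ x
  module y = ℝ y

  above : ∀ z {a} → z <ℚ a → proj₁ (ℝ.bounded z) < a
  above z {a} z<a with ℚ.<-cmp (proj₁ (ℝ.bounded z)) a
  ... | tri< l<a _ _ = l<a
  ... | tri≈ _ refl _ = contradiction z<a (proj₂ (ℝ.bounded z))
  ... | tri> _ _ a<l =
    contradiction (ℝ.upward z a<l z<a) (proj₂ (ℝ.bounded z))

  shift : ∀ a b {r} → a + b < r → b < r - a
  shift a b {r} a+b<r = subst (_< r - a) eq (ℚ.+-monoˡ-< (- a) a+b<r)
    where
    eq : a + b - a ≡ b
    eq = trans (ℚ.+-assoc a b (- a)) (p+[q-p]≡q a b)

≤ᴿ-isPartialOrder : IsPartialOrder _≈ᴿ_ _≤ᴿ_
≤ᴿ-isPartialOrder = record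
  { isPreorder = record
    { isEquivalence = record
      { refl  = (λ h → h) , (λ h → h)
      ; sym   = λ (f , g) → g , f
      ; trans = λ (f , g) (f′ , g′) → (λ h → f (f′ h)) , (λ h → g′ (g h))
      }
    ; reflexive = λ e {q} → proj₁ e {q}
    ; trans     = λ f g h → f (g h)
    }
  ; antisym = λ f g → (λ {q} → f {q}) , (λ {q} → g {q})
  }

-- Subsets are predicates valued in Set, whatever the level of the carrier;
-- under excluded middle every predicate is equivalent to such a one.  For
-- the same reason, families indexed by Set c suffice in open-⋃.

record Topology (S : Setoid c ℓ) (o : Level) : Set (lsuc (c ⊔ o) ⊔ lsuc 0ℓ ⊔ ℓ) where
  open Setoid S using (Carrier; _≈_)
  field
    IsOpen        : Pred (Pred Carrier 0ℓ) o
    open-respects : ∀ {V} → IsOpen V → V Respects _≈_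
    open-U        : IsOpen (λ _ → ⊤)
    open-∩        : ∀ {V W} → IsOpen V → IsOpen W → IsOpen (V ∩ W)
    open-⋃        : ∀ {I : Set c} {F : I → Pred Carrier 0ℓ} {V} →
                    (∀ i → IsOpen (F i)) → V ≐ ⋃ I F → IsOpen V

module _ {S : Setoid c ℓ} {T : Setoid c′ ℓ′} where
  private
    module S = Setoid S
    module T = Setoid T

  Continuous : Topology S o → Topology T o′ → (S.Carrier → T.Carrier) →
               Set (lsuc 0ℓ ⊔ o ⊔ o′ ⊔ c′)
  Continuous σ τ f = ∀ {V} → Topology.IsOpen τ V → Topology.IsOpen σ (λ x → V (f x))

-- Continuity of an operation on the product S × S, in terms of open boxes.

Continuous₂ : {S : Setoid c ℓ} → Topology S o → let open Setoid S in
              (Carrier → Carrier → Carrier) → Set (lsuc 0ℓ ⊔ o ⊔ c)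
Continuous₂ τ _∙_ = ∀ {N} → IsOpen N → ∀ {x y} → N (x ∙ y) →
  ∃₂ λ V W → IsOpen V × IsOpen W × V x × W y ×
  (∀ {x′ y′} → V x′ → W y′ → N (x′ ∙ y′))
  where open Topology τ

discrete : (S : Setoid c ℓ) → Topology S (c ⊔ ℓ)
discrete S = record
  { IsOpen        = λ V → V Respects _≈_
  ; open-respects = λ h → h
  ; open-U        = λ _ _ → tt
  ; open-∩        = λ f g e (v , w) → f e v , g e w
  ; open-⋃        = λ h (to , from) e v →
                      let i , w = to v in from (i , h i e w)
  }
  where open Setoid S

-- The product topology on countably many copies of a space: every point of
-- an open set has a basic box around it, constrained in finitely many
-- coordinates only.

sequences : Setoid c ℓ → Setoid c ℓ
sequences S = record
  { Carrier       = ℕ → Carrier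
  ; _≈_           = λ x y → ∀ k → x k ≈ y k
  ; isEquivalence = Pointwise.isEquivalence ℕ isEquivalence
  }
  where open Setoid S

module _ {S : Setoid c ℓ} (τ : Topology S o) where
  open Setoid S using (Carrier)
  open Topology τ

  Box : ℕ → (ℕ → Pred Carrier 0ℓ) → Pred (ℕ → Carrier) 0ℓ
  Box n V x = ∀ k → k ℕ.< n → V k (x k)

  productTopology : Topology (sequences S) (lsuc 0ℓ ⊔ c ⊔ o)
  productTopology = record
    { IsOpen        = λ N → ∀ {x} → N x → ∃₂ λ n V →
                        (∀ k → IsOpen (V k)) × Box n V x × Box n V ⊆ N
    ; open-respects = λ h x≈y N∋x →
                        let n , V , o , b , s = h N∋x in
                        s (λ k k<n → open-respects (o k) (x≈y k) (b k k<n))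
    ; open-U        = λ _ → 0 , (λ _ _ → ⊤) , (λ _ → open-U) , (λ _ _ → tt) , (λ _ → tt)
    ; open-∩        = λ f g (p , q) →
                        let n , V , o , b , s = f p
                            m , W , o′ , b′ , s′ = g q in
                        n ℕ.⊔ m ,
                        (λ k → Cut n (V k) k ∩ Cut m (W k) k) ,
                        (λ k → open-∩ (open-Cut n k (o k)) (open-Cut m k (o′ k))) ,
                        (λ k _ → (λ k<n → b k k<n) , (λ k<m → b′ k k<m)) ,
                        (λ z → s (λ k k<n → proj₁ (z k (ℕ.<-≤-trans k<n (ℕ.m≤m⊔n n m))) k<n) ,
                               s′ (λ k k<m → proj₂ (z k (ℕ.<-≤-trans k<m (ℕ.m≤n⊔m n m))) k<m))
    ; open-⋃        = λ h (to , from) N∋x →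
                        let i , y = to N∋x
                            n , V , o , b , s = h i y in
                        n , V , o , b , (λ z → from (i , s z))
    }
    where
    Cut : ℕ → Pred Carrier 0ℓ → ℕ → Pred Carrier 0ℓ
    Cut n V k x = k ℕ.< n → V x

    open-Cut : ∀ n k {V} → IsOpen V → IsOpen (Cut n V k)
    open-Cut n k oV with k ℕ.<? n
    ... | yes k<n =
      open-⋃ {I = Level.Lift _ ⊤} (λ _ → oV) ((λ f → _ , f k<n) , (λ (_ , v) _ → v))
    ... | no k≮n =
      open-⋃ {I = Level.Lift _ ⊤} (λ _ → open-U)
        ((λ _ → _ , tt) , (λ _ k<n → contradiction k<n k≮n))

record Metric (S : Setoid c ℓ) : Set (c ⊔ ℓ ⊔ lsuc 0ℓ) where
  open Setoid S using (Carrier; _≈_)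
  field
    d        : DistanceFunction Carrier ℝ
    isMetric : IsGeneralMetric _≈_ _≈ᴿ_ _≤ᴿ_ 0ᴿ _+ᴿ_ d

  open IsGeneralMetric isMetric public
    using (nonNegative; ≈⇒0; 0⇒≈; triangle)
    renaming (sym to d-sym)

  Ball : Carrier → ℚ → Pred Carrier 0ℓ
  Ball x ε y = d x y <ℚ ε

  topology : Topology S c
  topology = record
    { IsOpen        = λ V → ∀ {x} → V x → ∃ λ ε → 0ℚ < ε × Ball x ε ⊆ V
    ; open-respects = λ h x≈y Vx → let ε , 0<ε , s = h Vx in
                        s (proj₁ (≈⇒0 x≈y) 0<ε)
    ; open-U        = λ _ → ℚ.1ℚ , ℚ.positive⁻¹ ℚ.1ℚ , (λ _ → tt)
    ; open-∩        = λ f g (p , q) → inter (f p) (g q)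
    ; open-⋃        = λ h (to , from) Vx → let i , w = to Vx
                                               ε , 0<ε , s = h i w in
                        ε , 0<ε , (λ b → from (i , s b))
    }
    where
    widen : ∀ {x ε δ} → ε ≤ δ → Ball x ε ⊆ Ball x δ
    widen {x} {ε} {δ} ε≤δ {y} b with ℚ.<-cmp ε δ
    ... | tri< ε<δ _ _ = ℝ.upward (d x y) ε<δ b
    ... | tri≈ _ refl _ = b
    ... | tri> _ _ δ<ε = contradiction (ℚ.<-≤-trans δ<ε ε≤δ) (ℚ.<-irrefl refl)

    inter : ∀ {V W : Pred Carrier 0ℓ} {x} →
            (∃ λ ε → 0ℚ < ε × Ball x ε ⊆ V) → (∃ λ ε → 0ℚ < ε × Ball x ε ⊆ W) →
            ∃ λ ε → 0ℚ < ε × Ball x ε ⊆ V ∩ W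
    inter {x = x} (ε , 0<ε , s) (δ , 0<δ , t) with ℚ.≤-total ε δ
    ... | inj₁ ε≤δ = ε , 0<ε , λ {y} b → s b , t (widen ε≤δ {y} b)
    ... | inj₂ δ≤ε = δ , 0<δ , λ {y} b → s (widen δ≤ε {y} b) , t b

  centre : ∀ x {ε} → 0ℚ < ε → Ball x ε x
  centre x = proj₁ (≈⇒0 (Setoid.refl S))

  open-Ball : ∀ x ε → Topology.IsOpen topology (Ball x ε)
  open-Ball x ε {y} b =
    let r , r<ε , b′ = ℝ.rounded (d x y) b in
    ε - r , p<q⇒0<q-p r<ε , (λ {z} b″ → triangle x y z (r , ε - r , b′ , b″ , p+[q-p]≡q r ε))

  IsCauchy : (ℕ → Carrier) → Set
  IsCauchy s = ∀ {ε} → 0ℚ < ε → ∃ λ N → ∀ {m n} → N ℕ.≤ m → N ℕ.≤ n → d (s m) (s n) <ℚ ε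

  _ConvergesTo_ : (ℕ → Carrier) → Carrier → Set
  s ConvergesTo x = ∀ {ε} → 0ℚ < ε → ∃ λ N → ∀ {n} → N ℕ.≤ n → d (s n) x <ℚ ε

  IsComplete : Set c
  IsComplete = ∀ s → IsCauchy s → ∃ λ x → s ConvergesTo x

module _ {S : Setoid c ℓ} (τ : Topology S o) where
  open Setoid S using (Carrier)
  open Topology τ

  IsInducedBy : Metric S → Set (lsuc 0ℓ ⊔ c ⊔ o)
  IsInducedBy m = ∀ V → IsOpen V ⇔ Topology.IsOpen (Metric.topology m) V

  CompletelyMetrizable : Set (lsuc 0ℓ ⊔ c ⊔ ℓ ⊔ o)
  CompletelyMetrizable = Σ (Metric S) λ m → IsInducedBy m × Metric.IsComplete m

  -- The empty space, which is not a group, is excluded by this definition.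
  Separable : Set (lsuc 0ℓ ⊔ c ⊔ o)
  Separable = Σ (ℕ → Carrier) λ s → ∀ V → IsOpen V → ∃ V → ∃ λ n → V (s n)

  IsPolish : Set (lsuc 0ℓ ⊔ c ⊔ ℓ ⊔ o)
  IsPolish = Separable × CompletelyMetrizable

Uncountable : Setoid c ℓ → Set (c ⊔ ℓ)
Uncountable S = ¬ Injection S (≡.setoid ℕ)

record TopologicalAbelianGroup (c ℓ o : Level) : Set (lsuc (c ⊔ ℓ ⊔ o) ⊔ lsuc 0ℓ) where
  field
    abelianGroup : AbelianGroup c ℓ

  open AbelianGroup abelianGroup public

  field
    topology      : Topology setoid o
    ∙-continuous  : Continuous₂ topology _∙_
    ⁻¹-continuous : Continuous topology topology _⁻¹

record AbelianPolishGroup (c ℓ o : Level) : Set (lsuc (c ⊔ ℓ ⊔ o) ⊔ lsuc 0ℓ) where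
  field
    topologicalAbelianGroup : TopologicalAbelianGroup c ℓ o

  open TopologicalAbelianGroup topologicalAbelianGroup public

  field
    isPolish : IsPolish topology

infix 4 _⊑_

_⊑_ : TopologicalAbelianGroup c ℓ o → TopologicalAbelianGroup c′ ℓ′ o′ →
      Set (lsuc 0ℓ ⊔ c ⊔ ℓ ⊔ o ⊔ c′ ⊔ ℓ′ ⊔ o′)
M ⊑ N = Σ (M.Carrier → N.Carrier) λ f →
  IsGroupMonomorphism f × Continuous M.topology N.topology f
  where
  module M = TopologicalAbelianGroup M
  module N = TopologicalAbelianGroup N
  open GroupMorphisms M.rawGroup N.rawGroup using (IsGroupMonomorphism)

discreteGroup : AbelianGroup c 0ℓ → TopologicalAbelianGroup c 0ℓ c
discreteGroup G = record
  { abelianGroup  = G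
  ; topology      = discrete setoid
  ; ∙-continuous  = λ h {x} {y} v →
                      (x ≈_) , (y ≈_) , (λ e f → G.trans f e) , (λ e f → G.trans f e) ,
                      G.refl , G.refl , (λ e f → h (∙-cong e f) v)
  ; ⁻¹-continuous = λ h e v → h (⁻¹-cong e) v
  }
  where
  module G = AbelianGroup G
  open G using (_≈_; setoid; ∙-cong; ⁻¹-cong)

_^ℕ : TopologicalAbelianGroup c ℓ o → TopologicalAbelianGroup c ℓ (lsuc 0ℓ ⊔ c ⊔ o)
G ^ℕ = record
  { abelianGroup  = Pointwise.abelianGroup ℕ abelianGroup
  ; topology      = productTopology topology
  ; ∙-continuous  = λ h N∋xy →
      let n , V , oV , b , s = h N∋xy in
      let box = λ k → continuous k n (oV k) (b k) in
      Box topology n (λ k → proj₁ (box k)) , Box topology n (λ k → proj₁ (proj₂ (box k))) ,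
      open-Box n (λ k → proj₁ (proj₂ (proj₂ (box k)))) ,
      open-Box n (λ k → proj₁ (proj₂ (proj₂ (proj₂ (box k))))) ,
      (λ k k<n → proj₁ (proj₁ (proj₂ (proj₂ (proj₂ (proj₂ (box k))))) k<n)) ,
      (λ k k<n → proj₂ (proj₁ (proj₂ (proj₂ (proj₂ (proj₂ (box k))))) k<n)) ,
      (λ v w → s (λ k k<n → proj₂ (proj₂ (proj₂ (proj₂ (proj₂ (box k))))) k<n (v k k<n) (w k k<n)))
  ; ⁻¹-continuous = λ h N∋x →
      let n , V , oV , b , s = h N∋x in
      n , (λ k x → V k (x ⁻¹)) , (λ k → ⁻¹-continuous (oV k)) , b , (λ z → s z)
  }
  where
  open TopologicalAbelianGroup G
  open Topology topology

  open-Box : ∀ n {V} → (∀ k → IsOpen (V k)) →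
             Topology.IsOpen (productTopology topology) (Box topology n V)
  open-Box n oV b = n , _ , oV , b , (λ z → z)

  continuous : ∀ k n {N x y} → IsOpen N → (k ℕ.< n → N (x ∙ y)) →
    ∃₂ λ V W → IsOpen V × IsOpen W × (k ℕ.< n → V x × W y) ×
    (k ℕ.< n → ∀ {x′ y′} → V x′ → W y′ → N (x′ ∙ y′))
  continuous k n oN N∋xy with k ℕ.<? n
  ... | yes k<n =
    let V , W , oV , oW , x∈V , y∈W , s = ∙-continuous oN (N∋xy k<n) in
    V , W , oV , oW , (λ _ → x∈V , y∈W) , (λ _ → s)
  ... | no k≮n =
    _ , _ , open-U , open-U , (λ _ → tt , tt) , (λ k<n → contradiction k<n k≮n)

infix 8 ℤ/_ℤ

ℤ/_ℤ : ℕ → AbelianGroup 0ℓ 0ℓ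
ℤ/ p ℤ = record
  { Carrier        = ℤ
  ; _≈_            = λ i j → (ℤ.+ p) ∣ℤ (i ℤ.- j)
  ; _∙_            = ℤ._+_
  ; ε              = ℤ.0ℤ
  ; _⁻¹            = ℤ.-_
  ; isAbelianGroup = record
    { isGroup = record
      { isMonoid = record
        { isSemigroup = record
          { isMagma = record
            { isEquivalence = record
              { refl  = λ {i} → reflexive {i} refl
              ; sym   = λ {i} {j} e → subst (ℤ.+ p ∣ℤ_) (lemma-sym i j) (∣m⇒∣-m e)
              ; trans = λ {i} {j} {k} e f → subst (ℤ.+ p ∣ℤ_) (lemma-trans i j k) (∣m∣n⇒∣m+n e f)
              }
            ; ∙-cong = λ {i} {j} {k} {l} e f → subst (ℤ.+ p ∣ℤ_) (lemma-+ i j k l) (∣m∣n⇒∣m+n e f)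
            }
          ; assoc = λ i j k → reflexive (ℤ.+-assoc i j k)
          }
        ; identity = (λ i → reflexive (ℤ.+-identityˡ i)) , (λ i → reflexive (ℤ.+-identityʳ i))
        }
      ; inverse = (λ i → reflexive (ℤ.+-inverseˡ i)) , (λ i → reflexive (ℤ.+-inverseʳ i))
      ; ⁻¹-cong = λ {i} {j} e → subst (ℤ.+ p ∣ℤ_) (lemma-neg i j) (∣m⇒∣-m e)
      }
    ; comm = λ i j → reflexive (ℤ.+-comm i j)
    }
  }
  where
  open +-*-Solver

  reflexive : ∀ {i j} → i ≡ j → (ℤ.+ p) ∣ℤ (i ℤ.- j)
  reflexive {i} refl = divides ℤ.0ℤ (ℤ.+-inverseʳ i)

  lemma-sym : ∀ i j → ℤ.- (i ℤ.- j) ≡ j ℤ.- i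
  lemma-sym = solve 2 (λ i j → :- (i :- j) := j :- i) refl

  lemma-neg : ∀ i j → ℤ.- (i ℤ.- j) ≡ ℤ.- i ℤ.- (ℤ.- j)
  lemma-neg = solve 2 (λ i j → :- (i :- j) := :- i :- (:- j)) refl

  lemma-trans : ∀ i j k → (i ℤ.- j) ℤ.+ (j ℤ.- k) ≡ i ℤ.- k
  lemma-trans = solve 3 (λ i j k → (i :- j) :+ (j :- k) := i :- k) refl

  lemma-+ : ∀ i j k l → (i ℤ.- j) ℤ.+ (k ℤ.- l) ≡ (i ℤ.+ k) ℤ.- (j ℤ.+ l)
  lemma-+ = solve 4 (λ i j k l → (i :- j) :+ (k :- l) := (i :+ k) :- (j :+ l)) refl

[ℤ/_ℤ]^ℕ : ℕ → TopologicalAbelianGroup 0ℓ 0ℓ (lsuc 0ℓ)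
[ℤ/ p ℤ]^ℕ = discreteGroup (ℤ/ p ℤ) ^ℕ

partialSum : (ℕ → ℚ) → ℕ → ℚ
partialSum t zero    = 0ℚ
partialSum t (suc N) = partialSum t N + t N

-- The condition ∑ₖ tₖ < ∞ on a series with nonnegative terms.

Summable : (ℕ → ℚ) → Set
Summable t = ∃ λ B → ∀ N → partialSum t N ≤ B

-- The supremum of the partial sums; this is the sum of the series when its
-- terms are nonnegative.

sum : ∀ t → Summable t → ℝ
sum t (B , h) = record
  { _<ℚ_      = λ q → ∃ λ r → r < q × (∀ N → partialSum t N ≤ r)
  ; inhabited = B + ℚ.1ℚ , B ,
                subst (_< B + ℚ.1ℚ) (ℚ.+-identityʳ B) (ℚ.+-monoʳ-< B (ℚ.positive⁻¹ ℚ.1ℚ)) , h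
  ; bounded   = 0ℚ , λ (r , r<0 , b) → ℚ.<-irrefl refl (ℚ.<-≤-trans r<0 (b 0))
  ; upward    = λ q<q′ (r , r<q , b) → r , ℚ.<-trans r<q q<q′ , b
  ; rounded   = λ (r , r<q , b) → let q′ , r<q′ , q′<q = between r<q in
                  q′ , q′<q , r , r<q′ , b
  }

partialSum-mono : ∀ {t u} → (∀ k → t k ≤ u k) → ∀ N → partialSum t N ≤ partialSum u N
partialSum-mono h zero    = ℚ.≤-refl
partialSum-mono h (suc N) = ℚ.+-mono-≤ (partialSum-mono h N) (h N)

interchange : ∀ a b c d → (a + b) + (c + d) ≡ (a + c) + (b + d)
interchange a b c d = begin
  (a + b) + (c + d) ≡⟨ ℚ.+-assoc a b (c + d) ⟩
  a + (b + (c + d)) ≡⟨ cong (a +_) (sym (ℚ.+-assoc b c d)) ⟩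
  a + ((b + c) + d) ≡⟨ cong (λ z → a + (z + d)) (ℚ.+-comm b c) ⟩
  a + ((c + b) + d) ≡⟨ cong (a +_) (ℚ.+-assoc c b d) ⟩
  a + (c + (b + d)) ≡⟨ sym (ℚ.+-assoc a c (b + d)) ⟩
  (a + c) + (b + d) ∎
  where open ≡.≡-Reasoning

partialSum-+ : ∀ t u N → partialSum (λ k → t k + u k) N ≡ partialSum t N + partialSum u N
partialSum-+ t u zero    = sym (ℚ.+-identityʳ 0ℚ)
partialSum-+ t u (suc N) =
  trans (cong (_+ (t N + u N)) (partialSum-+ t u N))
        (interchange (partialSum t N) (partialSum u N) (t N) (u N))

partialSum-subadditive : ∀ {t u v} → (∀ k → t k ≤ u k + v k) → ∀ {a b} →
  (∀ N → partialSum u N ≤ a) → (∀ N → partialSum v N ≤ b) → ∀ N → partialSum t N ≤ a + b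
partialSum-subadditive {t} {u} {v} h p q N = ℚ.≤-trans (partialSum-mono h N)
  (subst (_≤ _) (sym (partialSum-+ u v N)) (ℚ.+-mono-≤ (p N) (q N)))

weight : (ℕ → ℤ) → ℕ → ℚ
weight x k = (ℤ.+ ∣ x k ∣ / k !) {{k ℕ.!≢0}}

/-toℚᵘ : ∀ m d .{{_ : ℕ.NonZero d}} → ℚ.toℚᵘ (ℤ.+ m / d) ℚᵘ.≃ (ℤ.+ m ℚᵘ./ d)
/-toℚᵘ m (suc d) = ℚ.toℚᵘ-fromℚᵘ (ℚᵘ.mkℚᵘ (ℤ.+ m) d)

/-subadditive : ∀ {m n o} d .{{_ : ℕ.NonZero d}} → m ℕ.≤ n ℕ.+ o →
                ℤ.+ m / d ≤ ℤ.+ n / d + ℤ.+ o / d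
/-subadditive {m} {n} {o} d@(suc d-1) m≤n+o = ℚ.toℚᵘ-cancel-≤ (begin
  ℚ.toℚᵘ (ℤ.+ m / d)                          ≃⟨ /-toℚᵘ m d ⟩
  ℤ.+ m ℚᵘ./ d                                ≤⟨ ℚᵘ.*≤* step ⟩
  ℤ.+ n ℚᵘ./ d ℚᵘ.+ ℤ.+ o ℚᵘ./ d              ≃⟨ ℚᵘ.+-cong (/-toℚᵘ n d) (/-toℚᵘ o d) ⟨
  ℚ.toℚᵘ (ℤ.+ n / d) ℚᵘ.+ ℚ.toℚᵘ (ℤ.+ o / d)  ≃⟨ ℚ.toℚᵘ-homo-+ (ℤ.+ n / d) (ℤ.+ o / d) ⟨
  ℚ.toℚᵘ (ℤ.+ n / d + ℤ.+ o / d)              ∎)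
  where
  open ℚᵘ.≤-Reasoning
  D = ℤ.+ d
  rearrange : ∀ n o D → (n ℤ.+ o) ℤ.* (D ℤ.* D) ≡ (n ℤ.* D ℤ.+ o ℤ.* D) ℤ.* D
  rearrange = solve 3 (λ n o D → (n :+ o) :* (D :* D) := (n :* D :+ o :* D) :* D) refl
    where open +-*-Solver
  step : ℤ.+ m ℤ.* (D ℤ.* D) ℤ.≤ (ℤ.+ n ℤ.* D ℤ.+ ℤ.+ o ℤ.* D) ℤ.* D
  step = subst (ℤ.+ m ℤ.* (D ℤ.* D) ℤ.≤_) (rearrange (ℤ.+ n) (ℤ.+ o) D)
           (ℤ.*-monoʳ-≤-nonNeg (D ℤ.* D) (ℤ.+≤+ m≤n+o))

weight-subadditive : ∀ x y z → (∀ k → ∣ x k ∣ ℕ.≤ ∣ y k ∣ ℕ.+ ∣ z k ∣) →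
                     ∀ k → weight x k ≤ weight y k + weight z k
weight-subadditive x y z h k = /-subadditive {∣ x k ∣} {∣ y k ∣} {∣ z k ∣} (k !) {{k ℕ.!≢0}} (h k)

weight-cong : ∀ x y → (∀ k → ∣ x k ∣ ≡ ∣ y k ∣) → ∀ N →
              partialSum (weight x) N ≡ partialSum (weight y) N
weight-cong x y h zero    = refl
weight-cong x y h (suc N) =
  cong₂ _+_ (weight-cong x y h N) (cong (λ m → (ℤ.+ m / N !) {{N ℕ.!≢0}}) (h N))

summable-cong : ∀ x y → (∀ k → ∣ x k ∣ ≡ ∣ y k ∣) → Summable (weight x) → Summable (weight y)
summable-cong x y h (B , b) = B , λ N → subst (_≤ B) (weight-cong x y h N) (b N)

weight-zeros : ∀ N → partialSum (weight (λ _ → ℤ.0ℤ)) N ≤ 0ℚ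
weight-zeros zero    = ℚ.≤-refl
weight-zeros (suc N) = ℚ.≤-trans
  (ℚ.+-mono-≤ (weight-zeros N) (ℚ.≤-reflexive (ℚ.0/n≡0 (N !) {{N ℕ.!≢0}})))
  (ℚ.≤-reflexive (ℚ.+-identityʳ 0ℚ))

ℓ¹-Carrier : Set
ℓ¹-Carrier = Σ (ℕ → ℤ) λ x → Summable (weight x)

ℓ¹-abelianGroup : AbelianGroup 0ℓ 0ℓ
ℓ¹-abelianGroup = record
  { Carrier        = ℓ¹-Carrier
  ; _≈_            = λ x y → ∀ k → proj₁ x k ≡ proj₁ y k
  ; _∙_            = λ (x , B , p) (y , C , q) →
                     (λ k → x k ℤ.+ y k) , B + C ,
                     partialSum-subadditive
                       (weight-subadditive (λ k → x k ℤ.+ y k) x y λ k → ℤ.∣i+j∣≤∣i∣+∣j∣ (x k) (y k)) p q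
  ; ε              = (λ _ → ℤ.0ℤ) , 0ℚ , weight-zeros
  ; _⁻¹            = λ (x , s) →
                     (λ k → ℤ.- x k) , summable-cong x (λ k → ℤ.- x k) (λ k → sym (ℤ.∣-i∣≡∣i∣ (x k))) s
  ; isAbelianGroup = record
    { isGroup = record
      { isMonoid = record
        { isSemigroup = record
          { isMagma = record
            { isEquivalence = record
              { refl  = λ _ → refl
              ; sym   = λ e k → sym (e k)
              ; trans = λ e f k → trans (e k) (f k)
              }
            ; ∙-cong = λ e f k → cong₂ ℤ._+_ (e k) (f k)
            }
          ; assoc = λ (x , _) (y , _) (z , _) k → ℤ.+-assoc (x k) (y k) (z k)
          }
        ; identity = (λ (x , _) k → ℤ.+-identityˡ (x k)) , (λ (x , _) k → ℤ.+-identityʳ (x k))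
        }
      ; inverse = (λ (x , _) k → ℤ.+-inverseˡ (x k)) , (λ (x , _) k → ℤ.+-inverseʳ (x k))
      ; ⁻¹-cong = λ e k → cong ℤ.-_ (e k)
      }
    ; comm = λ (x , _) (y , _) k → ℤ.+-comm (x k) (y k)
    }
  }
∥_∥₁ : ℓ¹-Carrier → ℝ
∥ x , s ∥₁ = sum (weight x) s

module ℓ¹ = AbelianGroup ℓ¹-abelianGroup

norm-triangle : ∀ x y z → (∀ k → ∣ proj₁ x k ∣ ℕ.≤ ∣ proj₁ y k ∣ ℕ.+ ∣ proj₁ z k ∣) →
                ∥ x ∥₁ ≤ᴿ ∥ y ∥₁ +ᴿ ∥ z ∥₁
norm-triangle (x , _) (y , _) (z , _) h (a , b , (a′ , a′<a , p) , (b′ , b′<b , q) , refl) =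
  a′ + b′ , ℚ.+-mono-< a′<a b′<b , partialSum-subadditive (weight-subadditive x y z h) p q

norm-cong : ∀ x y → (∀ k → ∣ proj₁ x k ∣ ≡ ∣ proj₁ y k ∣) → ∥ y ∥₁ ≤ᴿ ∥ x ∥₁
norm-cong (x , _) (y , _) h (r , r<q , p) =
  r , r<q , λ N → subst (_≤ r) (weight-cong x y h N) (p N)

norm-≥0 : ∀ x → 0ᴿ ≤ᴿ ∥ x ∥₁
norm-≥0 x (r , r<q , p) = ℚ.≤-<-trans (p 0) r<q

weight-≥0 : ∀ x k → 0ℚ ≤ weight x k
weight-≥0 x k = ℚ.nonNegative⁻¹ _ {{ℚ.normalize-nonNeg ∣ x k ∣ (k !) {{k ℕ.!≢0}}}}

weight-≤-norm : ∀ x k {q} → ∥ x ∥₁ <ℚ q → weight (proj₁ x) k < q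
weight-≤-norm (x , _) k {q} (r , r<q , p) = ℚ.≤-<-trans (ℚ.≤-trans
  (subst (_≤ partialSum (weight x) (suc k)) (ℚ.+-identityˡ (weight x k))
    (ℚ.+-monoˡ-≤ (weight x k) (nonneg k))) (p (suc k))) r<q
  where
  nonneg : ∀ N → 0ℚ ≤ partialSum (weight x) N
  nonneg zero    = ℚ.≤-refl
  nonneg (suc N) = ℚ.≤-trans (ℚ.≤-reflexive (sym (ℚ.+-identityʳ 0ℚ)))
                             (ℚ.+-mono-≤ (nonneg N) (weight-≥0 x N))

norm-definite : ∀ x → ∥ x ∥₁ ≤ᴿ 0ᴿ → ∀ k → proj₁ x k ≡ ℤ.0ℤ
norm-definite X@(x , _) h k = ℤ.∣i∣≡0⇒i≡0 (aux ∣ x k ∣ refl)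
  where
  aux : ∀ m → ∣ x k ∣ ≡ m → m ≡ 0
  aux zero    _  = refl
  aux (suc m) eq = contradiction (weight-≤-norm X k {weight x k} (h pos)) (ℚ.<-irrefl refl)
    where
    pos : 0ℚ < weight x k
    pos = subst (λ n → 0ℚ < (ℤ.+ n / k !) {{k ℕ.!≢0}}) (sym eq)
            (ℚ.positive⁻¹ _ {{ℚ.normalize-pos (suc m) (k !) {{k ℕ.!≢0}}}})

norm-0 : ∀ x → (∀ k → proj₁ x k ≡ ℤ.0ℤ) → ∥ x ∥₁ ≤ᴿ 0ᴿ
norm-0 x h 0<q =
  norm-cong ℓ¹.ε x (λ k → cong ∣_∣ (sym (h k))) (0ℚ , 0<q , weight-zeros)

difference : ∀ i j k → i ℤ.- k ≡ (i ℤ.- j) ℤ.+ (j ℤ.- k)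
difference = solve 3 (λ i j k → i :- k := (i :- j) :+ (j :- k)) refl
  where open +-*-Solver

difference-+ : ∀ i j k l → (i ℤ.+ j) ℤ.- (k ℤ.+ l) ≡ (i ℤ.- k) ℤ.+ (j ℤ.- l)
difference-+ = solve 4 (λ i j k l → (i :+ j) :- (k :+ l) := (i :- k) :+ (j :- l)) refl
  where open +-*-Solver

difference-neg : ∀ i j → ℤ.- i ℤ.- (ℤ.- j) ≡ ℤ.- (i ℤ.- j)
difference-neg = solve 2 (λ i j → :- i :- (:- j) := :- (i :- j)) refl
  where open +-*-Solver

∣∣-triangle : ∀ {k} i j → k ≡ i ℤ.+ j → ∣ k ∣ ℕ.≤ ∣ i ∣ ℕ.+ ∣ j ∣
∣∣-triangle i j refl = ℤ.∣i+j∣≤∣i∣+∣j∣ i j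

dist₁ : ℓ¹-Carrier → ℓ¹-Carrier → ℝ
dist₁ x y = ∥ x ℓ¹.∙ (y ℓ¹.⁻¹) ∥₁

ℓ¹-metric : Metric ℓ¹.setoid
ℓ¹-metric = record
  { d        = dist₁
  ; isMetric = record
    { isSemiMetric = record
      { isQuasiSemiMetric = record
        { isPreMetric = record
          { isProtoMetric = record
            { isPartialOrder  = ≤ᴿ-isPartialOrder
            ; ≈-isEquivalence = ℓ¹.isEquivalence
            ; cong            = λ {x} {x′} {y} {y′} e f →
                ≡⇒≈ (x ⊝ y) (x′ ⊝ y′) (λ k → cong ∣_∣ (cong₂ ℤ._-_ (e k) (f k)))
            ; nonNegative     = λ {x} {y} → norm-≥0 (x ⊝ y)
            }
          ; ≈⇒0 = λ {x} {y} e →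
              (λ {q} → norm-0 (x ⊝ y) (λ k → ℤ.i≡j⇒i-j≡0 (e k)) {q}) ,
              (λ {q} → norm-≥0 (x ⊝ y) {q})
          }
        ; 0⇒≈ = λ {x} {y} (h , _) k →
            ℤ.i-j≡0⇒i≡j (proj₁ x k) (proj₁ y k) (norm-definite (x ⊝ y) h k)
        }
      ; sym = λ x y →
          ≡⇒≈ (x ⊝ y) (y ⊝ x) (λ k → ℤ.∣i-j∣≡∣j-i∣ (proj₁ x k) (proj₁ y k))
      }
    ; triangle = λ x y z → norm-triangle (x ⊝ z) (x ⊝ y) (y ⊝ z) λ k →
        let i = proj₁ x k; j = proj₁ y k; l = proj₁ z k in
        ∣∣-triangle (i ℤ.- j) (j ℤ.- l) (difference i j l)
    }
  }
  where
  _⊝_ : ℓ¹-Carrier → ℓ¹-Carrier → ℓ¹-Carrier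
  x ⊝ y = x ℓ¹.∙ (y ℓ¹.⁻¹)

  ≡⇒≈ : ∀ x y → (∀ k → ∣ proj₁ x k ∣ ≡ ∣ proj₁ y k ∣) → ∥ x ∥₁ ≈ᴿ ∥ y ∥₁
  ≡⇒≈ x y h = norm-cong y x (λ k → sym (h k)) , norm-cong x y h

ℓ¹ℤ : TopologicalAbelianGroup 0ℓ 0ℓ 0ℓ
ℓ¹ℤ = record
  { abelianGroup  = ℓ¹-abelianGroup
  ; topology      = topology
  ; ∙-continuous  = λ oN {x} {y} N∋xy →
      let ε , 0<ε , s = oN N∋xy
          δ = ε ℚ.* ½ in
      Ball x δ , Ball y δ ,
      (λ {z} → open-Ball x δ {z}) , (λ {z} → open-Ball y δ {z}) ,
      centre x (half>0 0<ε) , centre y (half>0 0<ε) ,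
      (λ {x′} {y′} p q → s (dist-∙ x y x′ y′ (δ , δ , p , q , halves ε)))
  ; ⁻¹-continuous = λ oV {x} V∋x →
      let ε , 0<ε , s = oV V∋x in
      ε , 0<ε , (λ {y} b → s (dist-⁻¹ x y b))
  }
  where
  open Metric ℓ¹-metric

  dist-∙ : ∀ x y x′ y′ → dist₁ (x ℓ¹.∙ y) (x′ ℓ¹.∙ y′) ≤ᴿ dist₁ x x′ +ᴿ dist₁ y y′
  dist-∙ x y x′ y′ = norm-triangle
    ((x ℓ¹.∙ y) ℓ¹.∙ ((x′ ℓ¹.∙ y′) ℓ¹.⁻¹)) (x ℓ¹.∙ (x′ ℓ¹.⁻¹)) (y ℓ¹.∙ (y′ ℓ¹.⁻¹)) λ k →
    let i = proj₁ x k; j = proj₁ y k; i′ = proj₁ x′ k; j′ = proj₁ y′ k in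
    ∣∣-triangle (i ℤ.- i′) (j ℤ.- j′) (difference-+ i j i′ j′)

  dist-⁻¹ : ∀ x y → dist₁ (x ℓ¹.⁻¹) (y ℓ¹.⁻¹) ≤ᴿ dist₁ x y
  dist-⁻¹ x y = norm-cong (x ℓ¹.∙ (y ℓ¹.⁻¹)) ((x ℓ¹.⁻¹) ℓ¹.∙ ((y ℓ¹.⁻¹) ℓ¹.⁻¹)) λ k →
    let i = proj₁ x k; j = proj₁ y k in
    trans (sym (ℤ.∣-i∣≡∣i∣ (i ℤ.- j))) (cong ∣_∣ (sym (difference-neg i j)))

{-# OPTIONS --safe #-}

-- Choose a₀, a₁, … in A tending to 0 so fast that x ↦ Σ xₖ aₖ converges
-- whenever xₖ = O(k!): all the finitely many partial sums with coefficients
-- ∣xᵢ∣ ≤ (k + const) i! (i < k) move by a negligible amount when a multiple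
-- m aₖ with ∣m∣ ≤ (k + const) k! is added.  "Negligible" also means: compared
-- with the distance to 0 of those earlier partial sums that are nonzero.
-- Hence if the infinite sum is 0, then so are all late partial sums, and
-- injectivity reduces to an independence property of the aₖ.
--
-- If A[p] is not discrete for some prime p, take the aₖ nonzero in A[p];
-- coefficients are then residues mod p.  If all A[p] are discrete, they are
-- countable by separability, hence so are all A[m] and all the sets
-- { a ∣ m a ∈ D } with m ≠ 0 and D countable.  As neighbourhoods of 0 in A
-- are uncountable, aₖ can be chosen with no nonzero multiple in the span of
-- its predecessors.

module Submission where

open import Defs
open import Algebra.Bundles using (AbelianGroup)
open import Algebra.Morphism.Structures using (module GroupMorphisms)
import Algebra.Properties.AbelianGroup as AbelianGroupProperties
import Algebra.Properties.CommutativeMonoid.Mult as CommutativeMonoidMult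
import Algebra.Properties.CommutativeSemigroup as CommutativeSemigroupProperties
open import Axiom.ExcludedMiddle using (ExcludedMiddle)
open import Data.Integer.Base as ℤ using (ℤ; ∣_∣; -[1+_])
open import Data.Integer.Divisibility.Signed using (divides) renaming (_∣_ to _∣ℤ_)
open import Data.Integer.DivMod using (_%ℕ_; _/ℕ_; n%ℕd<d; a≡a%ℕn+[a/ℕn]*n)
import Data.Integer.Properties as ℤ
open import Data.Integer.Solver using (module +-*-Solver)
open import Data.List.Relation.Unary.All using (All; []; _∷_)
open import Data.List.Base using ([]; _∷_)
open import Data.Nat.Base as ℕ using (ℕ; zero; suc; _!)
open import Data.Nat.Coprimality using (Coprime; coprime-Bézout; prime⇒coprime)
open import Data.Nat.GCD using (module Bézout)
open Bézout using (Identity; +-; -+)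
open import Data.Nat.Induction using (<-rec)
open import Data.Nat.ListAction using (product)
open import Data.Nat.Primality using (Prime; prime⇒nonZero)
open import Data.Nat.Primality.Factorisation using (factorise; module PrimeFactorisation)
import Data.Nat.Properties as ℕ
open import Data.Product using (∃; ∃₂; Σ; _×_; _,_; proj₁; proj₂)
open import Data.Rational.Base as ℚ using (ℚ; 0ℚ; ½; mkℚ)
import Data.Rational.Properties as ℚ
import Data.Rational.Unnormalised.Base as ℚᵘ
import Data.Rational.Unnormalised.Properties as ℚᵘ
open import Data.Sum using (_⊎_; inj₁; inj₂)
open import Data.Vec.Base using (Vec; []; _∷_)
open import Function.Bundles using (Equivalence)
open import Function.Metric.Structures using (IsGeneralMetric)
open import Level using (Level; 0ℓ; _⊔_) renaming (suc to lsuc)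
open import Relation.Binary.Definitions using (tri<; tri≈; tri>)
open import Relation.Binary.PropositionalEquality as ≡
  using (_≡_; _≢_; refl; sym; trans; cong; subst)
import Relation.Binary.Reasoning.Setoid as SetoidReasoning
open import Relation.Nullary using (Dec; yes; no)
open import Relation.Nullary.Decidable using (decidable-stable)
open import Relation.Nullary.Negation using (¬_; contradiction)
open import Relation.Unary using (Pred)

private
  variable
    a b c c′ ℓ ℓ′ o o′ : Level

-- Integer multiples and integer combinations in an abelian group.

module IntegerMultiples (G : AbelianGroup c ℓ) where
  open AbelianGroup G renaming (refl to ≈-refl; sym to ≈-sym; trans to ≈-trans)
  open AbelianGroupProperties G
  open CommutativeSemigroupProperties commutativeSemigroup using ()
    renaming (interchange to ∙-interchange)
  open CommutativeMonoidMult commutativeMonoid using (×-homo-+; ×-congʳ; ×-distrib-+; ×-assocˡ)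
    renaming (_×_ to _×ᴺ_)
  open SetoidReasoning setoid

  infixr 7.5 _·_

  _·_ : ℤ → Carrier → Carrier
  ℤ.+ n    · x = n ×ᴺ x
  -[1+ n ] · x = (suc n ×ᴺ x) ⁻¹

  ·-congʳ : ∀ m {x y} → x ≈ y → m · x ≈ m · y
  ·-congʳ (ℤ.+ n)  e = ×-congʳ n e
  ·-congʳ -[1+ n ] e = ⁻¹-cong (×-congʳ (suc n) e)

  ·-congˡ : ∀ {m n} x → m ≡ n → m · x ≈ n · x
  ·-congˡ x refl = ≈-refl

  xy//xz≈y//z : ∀ x a b → (x ∙ a) ∙ (x ∙ b) ⁻¹ ≈ a ∙ b ⁻¹
  xy//xz≈y//z x a b = begin
    (x ∙ a) ∙ (x ∙ b) ⁻¹       ≈⟨ ∙-congˡ (⁻¹-∙-comm x b) ⟨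
    (x ∙ a) ∙ (x ⁻¹ ∙ b ⁻¹)    ≈⟨ ∙-interchange x a (x ⁻¹) (b ⁻¹) ⟩
    (x ∙ x ⁻¹) ∙ (a ∙ b ⁻¹)    ≈⟨ ∙-congʳ (inverseʳ x) ⟩
    ε ∙ (a ∙ b ⁻¹)             ≈⟨ identityˡ _ ⟩
    a ∙ b ⁻¹                   ∎

  ⊖-· : ∀ m n x → (m ℤ.⊖ n) · x ≈ m ×ᴺ x ∙ (n ×ᴺ x) ⁻¹
  ⊖-· m zero x = ≈-sym (≈-trans (∙-congˡ ε⁻¹≈ε) (identityʳ _))
  ⊖-· zero (suc n) x = ≈-sym (identityˡ _)
  ⊖-· (suc m) (suc n) x = begin
    (suc m ℤ.⊖ suc n) · x               ≈⟨ ·-congˡ x (ℤ.[1+m]⊖[1+n]≡m⊖n m n) ⟩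
    (m ℤ.⊖ n) · x                       ≈⟨ ⊖-· m n x ⟩
    m ×ᴺ x ∙ (n ×ᴺ x) ⁻¹                ≈⟨ xy//xz≈y//z x (m ×ᴺ x) (n ×ᴺ x) ⟨
    suc m ×ᴺ x ∙ (suc n ×ᴺ x) ⁻¹        ∎

  ·-homo-+ : ∀ m n x → (m ℤ.+ n) · x ≈ m · x ∙ n · x
  ·-homo-+ (ℤ.+ m)  (ℤ.+ n)  x = ×-homo-+ x m n
  ·-homo-+ (ℤ.+ m)  -[1+ n ] x = ⊖-· m (suc n) x
  ·-homo-+ -[1+ m ] (ℤ.+ n)  x = ≈-trans (⊖-· n (suc m) x) (comm _ _)
  ·-homo-+ -[1+ m ] -[1+ n ] x = begin
    (suc (suc (m ℕ.+ n)) ×ᴺ x) ⁻¹          ≡⟨ cong (λ k → (suc k ×ᴺ x) ⁻¹) (ℕ.+-suc m n) ⟨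
    ((suc m ℕ.+ suc n) ×ᴺ x) ⁻¹            ≈⟨ ⁻¹-cong (×-homo-+ x (suc m) (suc n)) ⟩
    (suc m ×ᴺ x ∙ suc n ×ᴺ x) ⁻¹           ≈⟨ ⁻¹-∙-comm _ _ ⟨
    (suc m ×ᴺ x) ⁻¹ ∙ (suc n ×ᴺ x) ⁻¹      ∎

  ·-homo-neg : ∀ m x → (ℤ.- m) · x ≈ (m · x) ⁻¹
  ·-homo-neg (ℤ.+ zero)  x = ≈-sym ε⁻¹≈ε
  ·-homo-neg (ℤ.+ suc n) x = ≈-refl
  ·-homo-neg -[1+ n ]    x = ≈-sym (⁻¹-involutive _)

  ·-distrib-∙ : ∀ m x y → m · (x ∙ y) ≈ m · x ∙ m · y
  ·-distrib-∙ (ℤ.+ n)  x y = ×-distrib-+ x y n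
  ·-distrib-∙ -[1+ n ] x y =
    ≈-trans (⁻¹-cong (×-distrib-+ x y (suc n))) (≈-sym (⁻¹-∙-comm _ _))

  ·-ε : ∀ m → m · ε ≈ ε
  ·-ε m = ∙-cancelˡ (m · ε) (m · ε) ε (begin
    m · ε ∙ m · ε   ≈⟨ ·-distrib-∙ m ε ε ⟨
    m · (ε ∙ ε)     ≈⟨ ·-congʳ m (identityˡ ε) ⟩
    m · ε           ≈⟨ identityʳ _ ⟨
    m · ε ∙ ε       ∎)

  ·-⁻¹ : ∀ m x → m · (x ⁻¹) ≈ (m · x) ⁻¹
  ·-⁻¹ m x = inverseʳ-unique (m · x) (m · (x ⁻¹)) (begin
    m · x ∙ m · (x ⁻¹) ≈⟨ ·-distrib-∙ m x (x ⁻¹) ⟨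
    m · (x ∙ x ⁻¹)     ≈⟨ ·-congʳ m (inverseʳ x) ⟩
    m · ε              ≈⟨ ·-ε m ⟩
    ε                  ∎)

  ·-assoc : ∀ m n x → (m ℤ.* ℤ.+ n) · x ≈ m · ℤ.+ n · x
  ·-assoc (ℤ.+ m) n x = begin
    (ℤ.+ m ℤ.* ℤ.+ n) · x   ≈⟨ ·-congˡ x (ℤ.pos-* m n) ⟨
    (m ℕ.* n) ×ᴺ x          ≈⟨ ×-assocˡ x m n ⟨
    ℤ.+ m · ℤ.+ n · x       ∎
  ·-assoc -[1+ m ] n x = begin
    (-[1+ m ] ℤ.* ℤ.+ n) · x           ≈⟨ ·-congˡ x (ℤ.neg-distribˡ-* (ℤ.+ suc m) (ℤ.+ n)) ⟨
    (ℤ.- (ℤ.+ suc m ℤ.* ℤ.+ n)) · x    ≈⟨ ·-homo-neg (ℤ.+ suc m ℤ.* ℤ.+ n) x ⟩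
    ((ℤ.+ suc m ℤ.* ℤ.+ n) · x) ⁻¹     ≈⟨ ⁻¹-cong (·-assoc (ℤ.+ suc m) n x) ⟩
    -[1+ m ] · ℤ.+ n · x               ∎

  ·-multiple : ∀ m p {x} → ℤ.+ p · x ≈ ε → (m ℤ.* ℤ.+ p) · x ≈ ε
  ·-multiple m p {x} px≈ε = ≈-trans (·-assoc m p x) (≈-trans (·-congʳ m px≈ε) (·-ε m))

  ·-∣∣ : ∀ m {x} → m · x ≈ ε → ℤ.+ ∣ m ∣ · x ≈ ε
  ·-∣∣ (ℤ.+ m)  e = e
  ·-∣∣ -[1+ m ] e = ⁻¹-injective (≈-trans e (≈-sym ε⁻¹≈ε))

  -- Bézout without subtraction yields a multiple of `m` and a multiple of `n` that differ by 1.
  -- Both annihilate `x`, and the difference of the two products is `x` itself.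
  coprime-annihilators : ∀ {m n x} → Coprime m n → ℤ.+ m · x ≈ ε → ℤ.+ n · x ≈ ε → x ≈ ε
  coprime-annihilators {m} {n} {x} coprime mx≈ε nx≈ε = combine (coprime-Bézout coprime)
    where
    multiple : ∀ k {i} → i ×ᴺ x ≈ ε → (k ℕ.* i) ×ᴺ x ≈ ε
    multiple k {i} e = ≈-trans (≈-sym (×-assocˡ x k i)) (≈-trans (×-congʳ k e) (·-ε (ℤ.+ k)))

    conclude : ∀ {i j} → 1 ℕ.+ i ≡ j → i ×ᴺ x ≈ ε → j ×ᴺ x ≈ ε → x ≈ ε
    conclude {i} refl ix≈ε jx≈ε = begin
      x             ≈⟨ identityʳ x ⟨
      x ∙ ε         ≈⟨ ∙-congˡ ix≈ε ⟨
      x ∙ i ×ᴺ x    ≈⟨ jx≈ε ⟩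
      ε             ∎

    combine : Identity 1 m n → x ≈ ε
    combine (+- i j eq) = conclude eq (multiple j nx≈ε) (multiple i mx≈ε)
    combine (-+ i j eq) = conclude eq (multiple i mx≈ε) (multiple j nx≈ε)

  -- Vectors are stored in reverse: the head carries the last coefficient.
  comb : ∀ {k} → Vec Carrier k → (ℕ → ℤ) → Carrier
  comb             []      x = ε
  comb {k = suc k} (a ∷ v) x = comb v x ∙ x k · a

  -- Makes combinations of elements of A[p] independent of the integers representing the residues.
  ·-mod : ∀ {p x} → ℤ.+ p · x ≈ ε → ∀ {m n} → ℤ.+ p ∣ℤ m ℤ.- n → m · x ≈ n · x
  ·-mod {p} {x} px≈ε {m} {n} (divides q m-n≡qp) = begin
    m · x                      ≈⟨ ·-congˡ x (m≡n+[m-n] m n) ⟩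
    (n ℤ.+ (m ℤ.- n)) · x      ≈⟨ ·-homo-+ n (m ℤ.- n) x ⟩
    n · x ∙ (m ℤ.- n) · x      ≈⟨ ∙-congˡ (·-congˡ x m-n≡qp) ⟩
    n · x ∙ (q ℤ.* ℤ.+ p) · x  ≈⟨ ∙-congˡ (·-multiple q p px≈ε) ⟩
    n · x ∙ ε                  ≈⟨ identityʳ _ ⟩
    n · x                      ∎
    where
    m≡n+[m-n] : ∀ m n → m ≡ n ℤ.+ (m ℤ.- n)
    m≡n+[m-n] = solve 2 (λ m n → m := n :+ (m :- n)) refl
      where open +-*-Solver

  comb-cong : ∀ {k} (v : Vec Carrier k) {x y} → (∀ i → x i ≡ y i) → comb v x ≈ comb v y
  comb-cong []      e = ≈-refl
  comb-cong (a ∷ v) e = ∙-cong (comb-cong v e) (·-congˡ a (e _))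

  comb-homo-+ : ∀ {k} (v : Vec Carrier k) x y → comb v (λ i → x i ℤ.+ y i) ≈ comb v x ∙ comb v y
  comb-homo-+ [] x y = ≈-sym (identityˡ ε)
  comb-homo-+ {suc k} (a ∷ v) x y = begin
    comb v (λ i → x i ℤ.+ y i) ∙ (x k ℤ.+ y k) · a        ≈⟨ ∙-cong (comb-homo-+ v x y) (·-homo-+ (x k) (y k) a) ⟩
    (comb v x ∙ comb v y) ∙ (x k · a ∙ y k · a)           ≈⟨ ∙-interchange _ _ _ _ ⟩
    (comb v x ∙ x k · a) ∙ (comb v y ∙ y k · a)           ∎

-- A surjection ℕ → ℕ × ℕ, walking along the antidiagonals.

next : ℕ × ℕ → ℕ × ℕ
next (i , zero)  = zero , suc i
next (i , suc j) = suc i , j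

unpair : ℕ → ℕ × ℕ
unpair zero    = zero , zero
unpair (suc n) = next (unpair n)

unpair-surjective : ∀ i j → ∃ λ n → unpair n ≡ (i , j)
unpair-surjective i j = diagonal (i ℕ.+ j) i j refl
  where
  diagonal : ∀ s i j → i ℕ.+ j ≡ s → ∃ λ n → unpair n ≡ (i , j)
  -- Recursion on the diagonal `s`, then on `i`; the predecessor of `(0 , j + 1)` is `(j , 0)`,
  -- where the previous diagonal ends.
  diagonal zero    zero    zero    _  = 0 , refl
  diagonal (suc s) zero    (suc j) eq =
    let n , e = diagonal s j zero (trans (ℕ.+-identityʳ j) (ℕ.suc-injective eq)) in
    suc n , cong next e
  diagonal s       (suc i) j       eq =
    let n , e = diagonal s i (suc j) (trans (ℕ.+-suc i j) eq) in
    suc n , cong next e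

-- Rational estimates and a sequence of radii.

/-drop-< : ∀ m n d e .{{_ : ℕ.NonZero d}} .{{_ : ℕ.NonZero e}} →
           ℤ.+ m ℚ./ d ℚ.< ℤ.+ n ℚ./ e → m ℕ.* e ℕ.< n ℕ.* d
/-drop-< m n (suc d) (suc e) h = ℤ.drop‿+<+
  (≡.subst₂ ℤ._<_ (sym (ℤ.pos-* m (suc e))) (sym (ℤ.pos-* n (suc d)))
    (ℚᵘ.drop-*<* (ℚᵘ.≤-<-trans (ℚᵘ.≤-reflexive (ℚᵘ.≃-sym (/-toℚᵘ m (suc d))))
      (ℚᵘ.<-≤-trans (ℚ.toℚᵘ-mono-< h) (ℚᵘ.≤-reflexive (/-toℚᵘ n (suc e)))))))

ceiling : ∀ q → ∃ λ n → q ℚ.≤ ℤ.+ n ℚ./ 1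
ceiling q@(mkℚ i d _) = ∣ i ∣ , ℚ.toℚᵘ-cancel-≤ (ℚᵘ.≤-trans (ℚᵘ.*≤* (h i))
    (ℚᵘ.≤-reflexive (ℚᵘ.≃-sym (/-toℚᵘ ∣ i ∣ 1))))
  where
  h : ∀ i → i ℤ.* ℤ.+ 1 ℤ.≤ ℤ.+ ∣ i ∣ ℤ.* ℤ.+ suc d
  h (ℤ.+ n) = ≡.subst₂ ℤ._≤_ (ℤ.pos-* n 1) (ℤ.pos-* n (suc d)) (ℤ.+≤+ (ℕ.*-monoʳ-≤ n (ℕ.s≤s ℕ.z≤n)))
  h -[1+ n ] = ℤ.≤-trans ℤ.-≤+ (ℤ.≤-reflexive (ℤ.pos-* (suc n) (suc d)))

1/suc : ℕ → ℚ
1/suc n = ℤ.+ 1 ℚ./ suc n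

0<1/suc : ∀ n → 0ℚ ℚ.< 1/suc n
0<1/suc n = ℚ.positive⁻¹ _ {{ℚ.normalize-pos 1 (suc n)}}

archimedean : ∀ {q} → 0ℚ ℚ.< q → ∃ λ n → 1/suc n ℚ.< q
archimedean {mkℚ (ℤ.+ suc i) d _} _ = suc d , ℚ.toℚᵘ-cancel-< (ℚᵘ.≤-<-trans
  (ℚᵘ.≤-reflexive (/-toℚᵘ 1 (suc (suc d)))) (ℚᵘ.*<* (≡.subst₂ ℤ._<_ (ℤ.pos-* 1 (suc d))
    (ℤ.pos-* (suc i) (suc (suc d))) (ℤ.+<+ h))))
  where
  h : 1 ℕ.* suc d ℕ.< suc i ℕ.* suc (suc d)
  h = ℕ.≤-trans (ℕ.≤-reflexive (cong suc (ℕ.*-identityˡ (suc d)))) (ℕ.m≤m+n (suc (suc d)) _)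
archimedean {mkℚ (ℤ.+ zero) d _} (ℚ.*<* (ℤ.+<+ ()))
archimedean {mkℚ -[1+ _ ] d _} (ℚ.*<* ())

-- Halving absorbs one use of the triangle inequality; the minimum with `1/suc n` makes convergence
-- to 0 immediate from the Archimedean property.
radius : ℕ → ℚ
radius zero    = ℚ.1ℚ
radius (suc n) = radius n ℚ.* ½ ℚ.⊓ 1/suc n

⊓-pos : ∀ {p q} → 0ℚ ℚ.< p → 0ℚ ℚ.< q → 0ℚ ℚ.< p ℚ.⊓ q
⊓-pos {p} {q} 0<p 0<q with ℚ.⊓-sel p q
... | inj₁ e = subst (0ℚ ℚ.<_) (sym e) 0<p
... | inj₂ e = subst (0ℚ ℚ.<_) (sym e) 0<q

radius>0 : ∀ n → 0ℚ ℚ.< radius n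
radius>0 zero    = ℚ.positive⁻¹ ℚ.1ℚ
radius>0 (suc n) = ⊓-pos (half>0 (radius>0 n)) (0<1/suc n)

radius-halves : ∀ n → radius (suc n) ℚ.+ radius (suc n) ℚ.≤ radius n
radius-halves n = ℚ.≤-trans (ℚ.+-mono-≤ h h) (ℚ.≤-reflexive (halves (radius n)))
  where
  h : radius (suc n) ℚ.≤ radius n ℚ.* ½
  h = ℚ.p⊓q≤p (radius n ℚ.* ½) (1/suc n)

radius-vanishes : ∀ {q} → 0ℚ ℚ.< q → ∃ λ n → radius n ℚ.< q
radius-vanishes 0<q = let n , h = archimedean 0<q in
  suc n , ℚ.≤-<-trans (ℚ.p⊓q≤q (radius n ℚ.* ½) (1/suc n)) h

-- A complete separable metric with the triangle inequality in the form in
-- which it is used: x ~[ n ] y stands for d x y < rₙ, where rₙ → 0 and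
-- rₙ₊₁ + rₙ₊₁ ≤ rₙ.

record Gauge (G : AbelianGroup c ℓ) : Set (c ⊔ ℓ ⊔ lsuc 0ℓ) where
  open AbelianGroup G using (Carrier; _≈_; _∙_; _⁻¹)
  infix 4 _~[_]_
  field
    _~[_]_        : Carrier → ℕ → Carrier → Set
    ~-refl        : ∀ {x n} → x ~[ n ] x
    ~-sym         : ∀ {x y n} → x ~[ n ] y → y ~[ n ] x
    ~-trans       : ∀ {x y z n} → x ~[ suc n ] y → y ~[ suc n ] z → x ~[ n ] z
    ~-weaken      : ∀ {x y m n} → m ℕ.≤ n → x ~[ n ] y → x ~[ m ] y
    ~-resp-≈      : ∀ {x x′ y y′ n} → x ≈ x′ → y ≈ y′ → x ~[ n ] y → x′ ~[ n ] y′
    separated     : ∀ {x y} → (∀ n → x ~[ n ] y) → x ≈ y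
    ∙-continuous  : ∀ x y n → ∃ λ m → ∀ {x′ y′} →
                    x ~[ m ] x′ → y ~[ m ] y′ → (x ∙ y) ~[ n ] (x′ ∙ y′)
    ⁻¹-continuous : ∀ x n → ∃ λ m → ∀ {x′} → x ~[ m ] x′ → (x ⁻¹) ~[ n ] (x′ ⁻¹)
    dense         : ℕ → Carrier
    isDense       : ∀ x n → ∃ λ i → x ~[ n ] dense i

  _⟶_ : (ℕ → Carrier) → Carrier → Set
  s ⟶ x = ∀ n → ∃ λ N → ∀ {i} → N ℕ.≤ i → s i ~[ n ] x

  field
    complete      : ∀ s → (∀ n → ∃ λ N → ∀ {i j} → N ℕ.≤ i → N ℕ.≤ j → s i ~[ n ] s j) →
                    ∃ λ x → s ⟶ x

-- The gauge of a Polish group.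

module FromMetric (A : AbelianPolishGroup c ℓ o) where
  open AbelianPolishGroup A hiding (topology; ∙-continuous; ⁻¹-continuous)
    renaming (refl to ≈-refl; sym to ≈-sym; trans to ≈-trans)
  module A = AbelianPolishGroup A
  open Metric (proj₁ (proj₂ isPolish))

  private
    induced : IsInducedBy A.topology (proj₁ (proj₂ isPolish))
    induced = proj₁ (proj₂ (proj₂ isPolish))

  ball-in-open : ∀ {V} → Topology.IsOpen A.topology V →
                 ∀ {x} → V x → ∃ λ n → ∀ {y} → d x y <ℚ radius n → V y
  ball-in-open {V} oV {x} Vx =
    let δ , 0<δ , s = Equivalence.to (induced V) oV Vx
        n , r<δ = radius-vanishes 0<δ in
    n , λ {y} b → s (ℝ.upward (d x y) r<δ b)

  open-ball : ∀ x n → Topology.IsOpen A.topology (Ball x (radius n))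
  open-ball x n = Equivalence.from (induced _) (λ {y} → open-Ball x (radius n) {y})

  widen : ∀ {x y p q} → p ℚ.≤ q → d x y <ℚ p → d x y <ℚ q
  widen {x} {y} {p} {q} p≤q b with ℚ.<-cmp p q
  ... | tri< p<q _ _ = ℝ.upward (d x y) p<q b
  ... | tri≈ _ refl _ = b
  ... | tri> _ _ q<p = contradiction (ℚ.<-≤-trans q<p p≤q) (ℚ.<-irrefl refl)

  radius-antitone : ∀ {m n} → m ℕ.≤ n → radius n ℚ.≤ radius m
  radius-antitone {m} {n} m≤n = go (ℕ.≤⇒≤′ m≤n)
    where
    step : ∀ n → radius (suc n) ℚ.≤ radius n
    step n = ℚ.≤-trans (subst (ℚ._≤ radius (suc n) ℚ.+ radius (suc n))
      (ℚ.+-identityʳ (radius (suc n)))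
      (ℚ.+-monoʳ-≤ (radius (suc n)) (ℚ.<⇒≤ (radius>0 (suc n))))) (radius-halves n)
    go : ∀ {n} → m ℕ.≤′ n → radius n ℚ.≤ radius m
    go ℕ.≤′-refl = ℚ.≤-refl
    go (ℕ.≤′-step {n} h) = ℚ.≤-trans (step n) (go h)

  gauge : Gauge abelianGroup
  gauge = record
    { _~[_]_        = λ x n y → d x y <ℚ radius n
    ; ~-refl        = λ {x} {n} → centre x (radius>0 n)
    ; ~-sym         = λ {x} {y} b → proj₂ (d-sym x y) b
    ; ~-trans       = λ {x} {y} {z} {n} b b′ → widen {x} {z} (radius-halves n)
                        (triangle x y z (_ , _ , b , b′ , refl))
    ; ~-weaken      = λ {x} {y} m≤n → widen {x} {y} (radius-antitone m≤n)
    ; ~-resp-≈      = λ x≈x′ y≈y′ b → proj₂ (IsGeneralMetric.cong isMetric x≈x′ y≈y′) b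
    ; separated     = λ {x} {y} h → 0⇒≈
                        ((λ 0<q → let n , r<q = radius-vanishes 0<q in ℝ.upward (d x y) r<q (h n)) ,
                         nonNegative)
    ; ∙-continuous  = λ x y n →
        let V , W , oV , oW , Vx , Wy , s =
              A.∙-continuous (open-ball (x ∙ y) n) {x} {y} (centre (x ∙ y) (radius>0 n))
            k , v = ball-in-open oV Vx
            l , w = ball-in-open oW Wy in
        k ℕ.⊔ l , λ {x′} {y′} b b′ →
          s (v (widen {x} {x′} (radius-antitone (ℕ.m≤m⊔n k l)) b))
            (w (widen {y} {y′} (radius-antitone (ℕ.m≤n⊔m k l)) b′))
    ; ⁻¹-continuous = λ x n →
        ball-in-open (A.⁻¹-continuous (open-ball (x ⁻¹) n)) (centre (x ⁻¹) (radius>0 n))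
    ; dense         = proj₁ (proj₁ isPolish)
    ; isDense       = λ x n →
        proj₂ (proj₁ isPolish) _ (open-ball x n) (x , centre x (radius>0 n))
    ; complete      = λ s h →
        let x , conv = proj₂ (proj₂ (proj₂ isPolish)) s λ 0<q →
              let n , r<q = radius-vanishes 0<q
                  N , b = h n in
              N , λ {i} {j} N≤i N≤j → ℝ.upward (d (s i) (s j)) r<q (b N≤i N≤j) in
        x , λ n → conv (radius>0 n)
    }

-- Countable sets, torsion and independence.

module Countability (em : ∀ {ℓ′} → ExcludedMiddle ℓ′) {G : AbelianGroup c ℓ} (Γ : Gauge G) where
  open AbelianGroup G renaming (refl to ≈-refl; sym to ≈-sym; trans to ≈-trans)
  open AbelianGroupProperties G
  open Gauge Γ
  open IntegerMultiples G
  open SetoidReasoning setoid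

  -- The sequence may leave `P`, so subsets inherit it and the empty set is included. It is given as
  -- data, so countable unions need no choice.
  Countable : Pred Carrier a → Set (c ⊔ ℓ ⊔ a)
  Countable P = Σ (ℕ → Carrier) λ s → ∀ {x} → P x → ∃ λ n → x ≈ s n

  countable-⊆ : {P : Pred Carrier a} {Q : Pred Carrier b} →
                (∀ {x} → P x → Q x) → Countable Q → Countable P
  countable-⊆ P⊆Q (s , h) = s , λ p → h (P⊆Q p)

  countable-⋃ : {P : ℕ → Pred Carrier a} → (∀ n → Countable (P n)) → Countable (λ x → ∃ λ n → P n x)
  countable-⋃ h = (λ k → let i , j = unpair k in proj₁ (h i) j) , λ (i , p) →
    let j , e = proj₂ (h i) p
        k , eq = unpair-surjective i j in
    k , ≈-trans e (reflexive (cong (λ (i , j) → proj₁ (h i) j) (sym eq)))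

  integer : ℕ → ℤ
  integer n = let i , j = unpair n in i ℤ.⊖ j

  integer-surjective : ∀ m → ∃ λ n → integer n ≡ m
  integer-surjective (ℤ.+ m) =
    let n , eq = unpair-surjective m 0 in n , cong (λ (i , j) → i ℤ.⊖ j) eq
  integer-surjective -[1+ m ] =
    let n , eq = unpair-surjective 0 (suc m) in n , cong (λ (i , j) → i ℤ.⊖ j) eq

  countable-⋃ℤ : {P : ℤ → Pred Carrier a} → (∀ m → Countable (P m)) → Countable (λ x → ∃ λ m → P m x)
  countable-⋃ℤ {P = P} h = countable-⊆
    (λ {x} (m , p) → let n , eq = integer-surjective m in n , subst (λ m → P m x) (sym eq) p)
    (countable-⋃ (λ n → h (integer n)))

  countable-≈ : ∀ y → Countable (_≈ y)
  countable-≈ y = (λ _ → y) , λ e → 0 , e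

  countable-∅ : {P : Pred Carrier a} → (∀ {x} → ¬ P x) → Countable P
  countable-∅ ¬P = (λ _ → ε) , λ p → contradiction p ¬P

  countable-translate : {P : Pred Carrier a} → Countable P → ∀ t → Countable (λ x → P (x ∙ t))
  countable-translate (s , h) t = (λ n → s n ∙ t ⁻¹) , λ {x} p → let n , e = h p in
    n , ≈-trans (≈-sym (//-rightDividesʳ t x)) (∙-congʳ e)

  least : ∀ {P : ℕ → Set a} {n} → P n → ∃ λ m → P m × (∀ {k} → k ℕ.< m → ¬ P k)
  least {P = P} {n} = <-rec (λ n → P n → ∃ λ m → P m × (∀ {k} → k ℕ.< m → ¬ P k)) step n
    where
    step : ∀ n → (∀ {k} → k ℕ.< n → P k → ∃ λ m → P m × (∀ {k} → k ℕ.< m → ¬ P k)) →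
           P n → ∃ λ m → P m × (∀ {k} → k ℕ.< m → ¬ P k)
    step n rec p with em {P = ∃ λ k → k ℕ.< n × P k}
    ... | yes (k , k<n , q) = rec k<n q
    ... | no none           = n , p , λ k<n q → none (_ , k<n , q)

  -- Each point goes to the least index at which it is enumerated; leastness makes this map respect
  -- `_≈_`.
  uncountable⇒¬countable : Uncountable setoid → {P : Pred Carrier a} → (∀ x → P x) → ¬ Countable P
  uncountable⇒¬countable uncountable P-all (s , h) = uncountable record
    { to        = index
    ; cong      = λ {x} {y} x≈y → ℕ.≤-antisym (index-≤ x≈y) (index-≤ (≈-sym x≈y))
    ; injective = λ {x} {y} eq → ≈-trans (proj₁ (proj₂ (first x)))
        (≈-trans (reflexive (cong s eq)) (≈-sym (proj₁ (proj₂ (first y)))))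
    }
    where
    first : ∀ x → ∃ λ n → x ≈ s n × (∀ {k} → k ℕ.< n → ¬ x ≈ s k)
    first x = least (proj₂ (h (P-all x)))

    index : Carrier → ℕ
    index x = proj₁ (first x)

    index-≤ : ∀ {x y} → x ≈ y → index x ℕ.≤ index y
    index-≤ {x} {y} x≈y = ℕ.≮⇒≥ λ lt →
      proj₂ (proj₂ (first x)) lt (≈-trans x≈y (proj₁ (proj₂ (first y))))

  -- The metric is not assumed invariant, so closeness of `x` to a dense point is carried to 0 by
  -- continuity of the operations at `x`. Countably many translates of any ball around 0 thus cover
  -- the group.
  dense-translate : ∀ x n → ∃ λ i → ε ~[ n ] x ∙ dense i ⁻¹
  dense-translate x n =
    let k , near   = ∙-continuous x (x ⁻¹) n
        l , near⁻¹ = ⁻¹-continuous x k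
        i , x~i    = isDense x l in
    i , ~-resp-≈ (inverseʳ x) ≈-refl (near ~-refl (near⁻¹ x~i))

  -- Were the ball contained in `P`, countably many translates of `P` would cover the group.
  escape : Uncountable setoid → {P : Pred Carrier a} → Countable P → ∀ n → ∃ λ x → ε ~[ n ] x × ¬ P x
  escape uncountable {P} P-countable n = decidable-stable em λ none →
    uncountable⇒¬countable uncountable
      (λ x → let i , near = dense-translate x n in
        i , decidable-stable em (λ ¬p → none (_ , near , ¬p)))
      (countable-⋃ (λ i → countable-translate P-countable (dense i ⁻¹)))

  Torsion : ℤ → Pred Carrier ℓ
  Torsion m x = m · x ≈ ε

  -- A fibre of multiplication by `m` is empty or a coset of A[m].
  countable-fibre : ∀ m → Countable (Torsion m) → ∀ t → Countable (λ x → m · x ≈ t)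
  countable-fibre m T-countable t with em {P = ∃ λ x → m · x ≈ t}
  ... | no none = countable-∅ λ e → none (_ , e)
  ... | yes (y , my≈t) = countable-⊆
    (λ {x} mx≈t → begin
      m · (x ∙ y ⁻¹)       ≈⟨ ·-distrib-∙ m x (y ⁻¹) ⟩
      m · x ∙ m · (y ⁻¹)   ≈⟨ ∙-cong (≈-trans mx≈t (≈-sym my≈t)) (·-⁻¹ m y) ⟩
      m · y ∙ (m · y) ⁻¹   ≈⟨ inverseʳ (m · y) ⟩
      ε                    ∎)
    (countable-translate T-countable (y ⁻¹))

  countable-preimage : ∀ m → Countable (Torsion m) → {P : Pred Carrier a} → Countable P →
                       Countable (λ x → P (m · x))
  countable-preimage m T-countable (s , h) =
    countable-⊆ h (countable-⋃ (λ n → countable-fibre m T-countable (s n)))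

  DiscreteTorsion : ℕ → Set (c ⊔ ℓ)
  DiscreteTorsion p = ∃ λ n → ∀ {x} → Torsion (ℤ.+ p) x → ε ~[ n ] x → x ≈ ε

  -- Points of A[p] close to the same dense point differ by a small element
  -- of A[p].
  discrete⇒countable : ∀ p → DiscreteTorsion p → Countable (Torsion (ℤ.+ p))
  discrete⇒countable p (n , discrete) =
    -- The decision is an explicit argument of `pick`, so that `pick-≈` can match on it. The value
    -- `ε` is a default for dense points with no torsion point nearby.
    (λ i → pick i em) , λ {x} px≈ε → let i , near = dense-translate x k in i , pick-≈ i em px≈ε near
    where
    -- Sums of two elements within `l` of 0 are within `n` of 0, and inverses of elements within `k`
    -- are within `l`.
    l = proj₁ (∙-continuous ε ε n)
    k = proj₁ (⁻¹-continuous ε l) ℕ.⊔ l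

    Near : ℕ → Carrier → Set ℓ
    Near i x = Torsion (ℤ.+ p) x × ε ~[ k ] x ∙ dense i ⁻¹

    pick : ∀ i → Dec (∃ (Near i)) → Carrier
    pick i (yes (x , _)) = x
    pick i (no _)        = ε

    difference-of-translates : ∀ x y t → (x ∙ t ⁻¹) ∙ (y ∙ t ⁻¹) ⁻¹ ≈ x ∙ y ⁻¹
    difference-of-translates x y t = begin
      (x ∙ t ⁻¹) ∙ (y ∙ t ⁻¹) ⁻¹   ≈⟨ ∙-cong (comm x (t ⁻¹)) (⁻¹-cong (comm y (t ⁻¹))) ⟩
      (t ⁻¹ ∙ x) ∙ (t ⁻¹ ∙ y) ⁻¹   ≈⟨ xy//xz≈y//z (t ⁻¹) x y ⟩
      x ∙ y ⁻¹                     ∎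

    pick-≈ : ∀ i d {x} → Torsion (ℤ.+ p) x → ε ~[ k ] x ∙ dense i ⁻¹ → x ≈ pick i d
    pick-≈ i (no none) px≈ε near = contradiction (_ , px≈ε , near) none
    pick-≈ i (yes (y , py≈ε , near′)) {x} px≈ε near = x∙y⁻¹≈ε⇒x≈y x y (discrete
      (begin
        ℤ.+ p · (x ∙ y ⁻¹)              ≈⟨ ·-distrib-∙ (ℤ.+ p) x (y ⁻¹) ⟩
        ℤ.+ p · x ∙ ℤ.+ p · (y ⁻¹)      ≈⟨ ∙-cong px≈ε (≈-trans (·-⁻¹ (ℤ.+ p) y) (⁻¹-cong py≈ε)) ⟩
        ε ∙ ε ⁻¹                        ≈⟨ inverseʳ ε ⟩
        ε                               ∎)
      (~-resp-≈ (identityˡ ε) (difference-of-translates x y (dense i))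
        (proj₂ (∙-continuous ε ε n) (~-weaken (ℕ.m≤n⊔m _ l) near)
          (~-resp-≈ ε⁻¹≈ε ≈-refl
            (proj₂ (⁻¹-continuous ε l) (~-weaken (ℕ.m≤m⊔n _ l) near′))))))

  -- Induction on the prime factorisation of `∣ m ∣`: A[pq] is the preimage of A[p] under
  -- multiplication by q, whose kernel A[q] is countable by induction.
  torsion-countable : (∀ p → Prime p → Countable (Torsion (ℤ.+ p))) →
                      ∀ m → m ≢ ℤ.0ℤ → Countable (Torsion m)
  torsion-countable prime-countable m m≢0 = countable-⊆
    (λ {x} mx≈ε → ≈-trans (·-congˡ x (cong ℤ.+_ (sym isFactorisation))) (·-∣∣ m mx≈ε))
    (products factorsPrime)
    where
    open PrimeFactorisation (factorise ∣ m ∣ {{ℕ.≢-nonZero λ e → m≢0 (ℤ.∣i∣≡0⇒i≡0 e)}})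

    products : ∀ {ps} → All Prime ps → Countable (Torsion (ℤ.+ product ps))
    products [] = countable-⊆ (λ e → ≈-trans (≈-sym (identityʳ _)) e) (countable-≈ ε)
    products {p ∷ ps} (p-prime ∷ ps-prime) = countable-⊆
      (λ {x} e → ≈-trans (≈-sym (·-assoc (ℤ.+ p) (product ps) x))
                   (≈-trans (·-congˡ x (sym (ℤ.pos-* p (product ps)))) e))
      (countable-preimage (ℤ.+ product ps) (products ps-prime) (prime-countable p p-prime))

  Span : ∀ {k} → Vec Carrier k → Pred Carrier ℓ
  Span v y = ∃ λ x → y ≈ comb v x

  -- Although the coefficient sequences are uncountably many, only the first `k` entries matter.
  -- Sorting by the last of these gives a union over ℤ of translates of the preceding span.
  span-countable : ∀ {k} (v : Vec Carrier k) → Countable (Span v)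
  span-countable [] = countable-⊆ proj₂ (countable-≈ ε)
  span-countable {suc k} (a ∷ v) = countable-⊆
    (λ {y} (x , e) → x k , x , (begin
      y ∙ (x k · a) ⁻¹                     ≈⟨ ∙-congʳ e ⟩
      (comb v x ∙ x k · a) ∙ (x k · a) ⁻¹  ≈⟨ //-rightDividesʳ (x k · a) (comb v x) ⟩
      comb v x                             ∎))
    (countable-⋃ℤ (λ m → countable-translate (span-countable v) ((m · a) ⁻¹)))

  small-independent : Uncountable setoid → (∀ p → Prime p → DiscreteTorsion p) →
                      ∀ {k} (v : Vec Carrier k) n →
                      ∃ λ a → ε ~[ n ] a × (∀ m → Span v (m · a) → m ≡ ℤ.0ℤ)
  small-independent uncountable discrete v n =
    let a , near , independent = escape uncountable (countable-⋃ℤ dependent-countable) n in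
    a , near , λ m h → decidable-stable em (λ m≢0 → independent (m , m≢0 , h))
    where
    -- Including `m ≢ 0` in the predicate makes it empty at 0, so the union can run over all of ℤ.
    dependent-countable : ∀ m → Countable (λ a → m ≢ ℤ.0ℤ × Span v (m · a))
    dependent-countable m with m ℤ.≟ ℤ.0ℤ
    ... | yes m≡0 = countable-∅ λ (m≢0 , _) → m≢0 m≡0
    ... | no  m≢0 = countable-⊆ proj₂ (countable-preimage m
      (torsion-countable (λ p p-prime → discrete⇒countable p (discrete p p-prime)) m m≢0)
      (span-countable v))

-- Limits, and estimates uniform over bounded coefficients.

Bounded : ℕ → (ℕ → ℤ) → Set
Bounded C x = ∀ k → ∣ x k ∣ ℕ.≤ C ℕ.* k !

module Limits {G : AbelianGroup c ℓ} (Γ : Gauge G) where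
  open AbelianGroup G renaming (refl to ≈-refl; sym to ≈-sym; trans to ≈-trans)
  open AbelianGroupProperties G
  open Gauge Γ
  open IntegerMultiples G

  ⟶-unique : ∀ {s x y} → s ⟶ x → s ⟶ y → x ≈ y
  ⟶-unique s⟶x s⟶y = separated λ n →
    let M , near = s⟶x (suc n); N , near′ = s⟶y (suc n) in
    ~-trans (~-sym (near (ℕ.m≤m⊔n M N))) (near′ (ℕ.m≤n⊔m M N))

  ⟶-resp-≈ : ∀ {s t x} → (∀ k → s k ≈ t k) → s ⟶ x → t ⟶ x
  ⟶-resp-≈ s≈t s⟶x n = let N , near = s⟶x n in
    N , λ N≤i → ~-resp-≈ (s≈t _) ≈-refl (near N≤i)

  ⟶-∙ : ∀ {s t x y} → s ⟶ x → t ⟶ y → (λ k → s k ∙ t k) ⟶ (x ∙ y)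
  ⟶-∙ {x = x} {y} s⟶x t⟶y n =
    let m , near = ∙-continuous x y n
        M , s~x = s⟶x m; N , t~y = t⟶y m in
    M ℕ.⊔ N , λ M⊔N≤i → ~-sym (near
      (~-sym (s~x (ℕ.≤-trans (ℕ.m≤m⊔n M N) M⊔N≤i)))
      (~-sym (t~y (ℕ.≤-trans (ℕ.m≤n⊔m M N) M⊔N≤i))))

  ·-continuous-ε : ∀ m n → ∃ λ l → ∀ {a} → ε ~[ l ] a → ε ~[ n ] m · a
  ·-continuous-ε (ℤ.+ i)  = natural i
    where
    natural : ∀ i n → ∃ λ l → ∀ {a} → ε ~[ l ] a → ε ~[ n ] ℤ.+ i · a
    natural zero    n = 0 , λ _ → ~-refl
    natural (suc i) n =
      let m , near  = ∙-continuous ε ε n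
          l , near′ = natural i m in
      m ℕ.⊔ l , λ b → ~-resp-≈ (identityˡ ε) ≈-refl
        (near (~-weaken (ℕ.m≤m⊔n m l) b) (near′ (~-weaken (ℕ.m≤n⊔m m l) b)))
  ·-continuous-ε -[1+ i ] n =
    let m , near  = ⁻¹-continuous ε n
        l , near′ = ·-continuous-ε (ℤ.+ suc i) m in
    l , λ b → ~-resp-≈ ε⁻¹≈ε ≈-refl (near (near′ b))

  perturb : ∀ y m n → ∃ λ l → ∀ {a} → ε ~[ l ] a → y ~[ n ] y ∙ m · a
  perturb y m n =
    let k , near  = ∙-continuous y ε n
        l , near′ = ·-continuous-ε m k in
    l , λ b → ~-resp-≈ (identityʳ y) ≈-refl (near ~-refl (near′ b))

  uniform-ℤ : (P : ℤ → ℕ → Set a) → (∀ {m i j} → i ℕ.≤ j → P m i → P m j) →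
              (∀ m → ∃ (P m)) → ∀ M → ∃ λ n → ∀ m → ∣ m ∣ ℕ.≤ M → P m n
  uniform-ℤ P mono h zero = proj₁ (h ℤ.0ℤ) , λ m ∣m∣≤0 →
    subst (λ m → P m _) (sym (ℤ.∣i∣≡0⇒i≡0 (ℕ.n≤0⇒n≡0 ∣m∣≤0))) (proj₂ (h ℤ.0ℤ))
  uniform-ℤ P mono h (suc M) =
    let n , all = uniform-ℤ P mono h M
        i , p = h (ℤ.+ suc M)
        j , q = h -[1+ M ] in
    n ℕ.⊔ (i ℕ.⊔ j) ,
    λ m le → extend n i j all p q m (ℕ.m≤n⇒m<n∨m≡n le)
    where
    extend : ∀ n i j → (∀ m → ∣ m ∣ ℕ.≤ M → P m n) → P (ℤ.+ suc M) i → P -[1+ M ] j →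
             ∀ m → _ → P m (n ℕ.⊔ (i ℕ.⊔ j))
    extend n i j all p q m (inj₁ lt) = mono (ℕ.m≤m⊔n n _) (all m (ℕ.s≤s⁻¹ lt))
    extend n i j all p q (ℤ.+ _)  (inj₂ refl) = mono (ℕ.≤-trans (ℕ.m≤m⊔n i j) (ℕ.m≤n⊔m n _)) p
    extend n i j all p q -[1+ _ ] (inj₂ refl) = mono (ℕ.≤-trans (ℕ.m≤n⊔m i j) (ℕ.m≤n⊔m n _)) q

  -- Bounded coefficients give only finitely many combinations, so a maximum of the individual
  -- bounds works. In the induction the quantifier over the last coefficient is absorbed into `P`,
  -- where `uniform-ℤ` handles it.
  uniform-comb : ∀ {k} (v : Vec Carrier k) C (P : Carrier → ℕ → Set a) →
                 (∀ {y i j} → i ℕ.≤ j → P y i → P y j) → (∀ y → ∃ (P y)) →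
                 ∃ λ n → ∀ x → Bounded C x → P (comb v x) n
  uniform-comb [] C P mono h = proj₁ (h ε) , λ _ _ → proj₂ (h ε)
  uniform-comb {k = suc k} (a ∷ v) C P mono h =
    let n , all = uniform-comb v C (λ y n → ∀ m → ∣ m ∣ ℕ.≤ C ℕ.* k ! → P (y ∙ m · a) n)
          (λ i≤j p m le → mono i≤j (p m le))
          (λ y → uniform-ℤ (λ m → P (y ∙ m · a)) mono (λ m → h (y ∙ m · a)) (C ℕ.* k !)) in
    n , λ x bounded → all x bounded (x k) (bounded k)

-- Inductive choice of the terms and convergence of the sums.

record TermPolicy {G : AbelianGroup c ℓ} (Γ : Gauge G) (g : Level) : Set (c ⊔ lsuc g) where
  open AbelianGroup G using (Carrier; ε)
  open Gauge Γ using (_~[_]_)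
  field
    -- The algebraic condition in which the two cases differ: independence from the predecessors, or
    -- being a nonzero element of A[p].
    Good : ∀ {k} → Vec Carrier k → Pred Carrier g
    good : ∀ {k} (v : Vec Carrier k) n → ∃ λ a → ε ~[ n ] a × Good v a

module Construction (em : ∀ {ℓ′} → ExcludedMiddle ℓ′) {G : AbelianGroup c ℓ} (Γ : Gauge G)
                    (slack : ℕ) {g : Level} (policy : TermPolicy Γ g) where
  open AbelianGroup G using (Carrier; ε; _≈_; _∙_; ∙-cong; identityˡ)
    renaming (refl to ≈-refl; sym to ≈-sym; trans to ≈-trans)
  open Gauge Γ
  open IntegerMultiples G
  open Limits Γ
  open TermPolicy policy

  -- The slack admits residues mod p, bounded by p · i! only, from stage 0 on;
  -- the two extra halvings in 2 + e pay for summing the tail and for passing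
  -- to the limit.
  Small : ∀ {k} → Vec Carrier k → ℕ → Carrier → Set
  Small {k} v e a = ∀ x → Bounded (k ℕ.+ slack) x → ∀ m → ∣ m ∣ ℕ.≤ (k ℕ.+ slack) ℕ.* k ! →
                    comb v x ~[ suc (suc e) ] comb v x ∙ m · a

  -- This is what turns a vanishing limit into vanishing partial sums.
  Separating : ∀ {k} → Vec Carrier k → ℕ → Set ℓ
  Separating {k} v e = ∀ x → Bounded (k ℕ.+ slack) x → ε ~[ e ] comb v x → comb v x ≈ ε

  abstract
    extension : ∀ {k} (v : Vec Carrier k) e → ∃ λ a → Small v e a × Good v a
    extension {k} v e =
      let n , all = uniform-comb v (k ℕ.+ slack)
            (λ y n → ∀ m → ∣ m ∣ ℕ.≤ (k ℕ.+ slack) ℕ.* k ! →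
                     ∀ {a} → ε ~[ n ] a → y ~[ suc (suc e) ] y ∙ m · a)
            (λ i≤j h m le b → h m le (~-weaken i≤j b))
            (λ y → uniform-ℤ (λ m n → ∀ {a} → ε ~[ n ] a → y ~[ suc (suc e) ] y ∙ m · a)
               (λ i≤j h b → h (~-weaken i≤j b)) (λ m → perturb y m _) _)
          a , near , a-good = good v n in
      a , (λ x bounded m le → all x bounded m le near) , a-good

    separation : ∀ {k} (v : Vec Carrier k) → ∃ (Separating v)
    separation {k} v = uniform-comb v (k ℕ.+ slack) (λ y n → ε ~[ n ] y → y ≈ ε)
      (λ i≤j h b → h (~-weaken i≤j b)) separate
      where
      -- If no `n` worked, `y` would be within every level of 0, hence equal to 0, and then every
      -- `n` would work.
      separate : ∀ y → ∃ λ n → ε ~[ n ] y → y ≈ ε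
      separate y = decidable-stable em λ none →
        none (0 , λ _ → ≈-sym (separated λ n → decidable-stable em
          λ far → none (n , λ near → contradiction near far)))

  stage : ∀ k → Vec Carrier k × ℕ
  stage zero    = [] , 0
  stage (suc k) =
    let v , e = stage k
        w = proj₁ (extension v e) ∷ v in
    -- `suc e` makes the errors at least halve from stage to stage; the maximum makes the new level
    -- separate the combinations of the new basis.
    w , suc e ℕ.⊔ proj₁ (separation w)

  basis : ∀ k → Vec Carrier k
  basis k = proj₁ (stage k)

  level : ℕ → ℕ
  level k = proj₂ (stage k)

  term : ℕ → Carrier
  term k = proj₁ (extension (basis k) (level k))

  term-small : ∀ k → Small (basis k) (level k) (term k)
  term-small k = proj₁ (proj₂ (extension (basis k) (level k)))

  term-good : ∀ k → Good (basis k) (term k)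
  term-good k = proj₂ (proj₂ (extension (basis k) (level k)))

  basis-separating : ∀ k → Separating (basis k) (level k)
  basis-separating zero    x bounded near = ≈-refl
  basis-separating (suc k) x bounded near =
    proj₂ (separation (basis (suc k))) x bounded (~-weaken (ℕ.m≤n⊔m (suc (level k)) _) near)

  level-increasing : ∀ k → level k ℕ.< level (suc k)
  level-increasing k = ℕ.m≤m⊔n (suc (level k)) (proj₁ (separation (basis (suc k))))

  k≤level : ∀ k → k ℕ.≤ level k
  k≤level zero    = ℕ.z≤n
  k≤level (suc k) = ℕ.≤-trans (ℕ.s≤s (k≤level k)) (level-increasing k)

  S : (ℕ → ℤ) → ℕ → Carrier
  S x k = comb (basis k) x

  S-zero : ∀ {x} k → (∀ {i} → i ℕ.< k → x i · term i ≈ ε) → S x k ≈ ε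
  S-zero zero    h = ≈-refl
  S-zero (suc k) h = ≈-trans (∙-cong (S-zero k (λ i<k → h (ℕ.m<n⇒m<1+n i<k))) (h ℕ.≤-refl)) (identityˡ ε)

  module _ {C x} (bounded : Bounded C x) where

    widened : ∀ {k} → C ℕ.≤ k ℕ.+ slack → Bounded (k ℕ.+ slack) x
    widened C≤k i = ℕ.≤-trans (bounded i) (ℕ.*-monoˡ-≤ (i !) C≤k)

    S-step : ∀ {k} → C ℕ.≤ k ℕ.+ slack → S x k ~[ suc (suc (level k)) ] S x (suc k)
    S-step {k} C≤k = term-small k x (widened C≤k) (x k) (widened C≤k k)

    -- The last summand moves `S x k` by less than the level that separates it from 0.
    S-prefix-vanishes : ∀ {k} → C ℕ.≤ k ℕ.+ slack → S x (suc k) ≈ ε → S x k ≈ ε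
    S-prefix-vanishes {k} C≤k S≈ε = basis-separating k x (widened C≤k)
      (~-weaken (ℕ.≤-trans (ℕ.n≤1+n _) (ℕ.n≤1+n _)) (~-sym (~-resp-≈ ≈-refl S≈ε (S-step C≤k))))

    -- A geometric series: the first step costs `suc (suc (level k))`, and the remaining tail, by
    -- induction from the strictly higher next level, costs no more.
    S-tail : ∀ {k n} → C ℕ.≤ k ℕ.+ slack → k ℕ.≤ n → S x k ~[ suc (level k) ] S x n
    S-tail {k} {n} C≤k k≤n = go (n ℕ.∸ k) C≤k (ℕ.m∸n+n≡m k≤n)
      where
      go : ∀ d {k} → C ℕ.≤ k ℕ.+ slack → d ℕ.+ k ≡ n → S x k ~[ suc (level k) ] S x n
      go zero        C≤k refl = ~-refl
      go (suc d) {k} C≤k eq   = ~-trans (S-step C≤k)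
        (~-weaken (ℕ.s≤s (level-increasing k))
          (go d (ℕ.≤-trans C≤k (ℕ.n≤1+n _)) (trans (ℕ.+-suc d k) eq)))

    limit : ∃ λ y → S x ⟶ y
    limit = complete (S x) λ n →
      let N = n ℕ.⊔ C
          C≤N = ℕ.≤-trans (ℕ.m≤n⊔m n C) (ℕ.m≤m+n N slack) in
      N , λ N≤i N≤j → ~-weaken (ℕ.≤-trans (ℕ.m≤m⊔n n C) (k≤level N))
        (~-trans (~-sym (S-tail C≤N N≤i)) (S-tail C≤N N≤j))

    -- Compare through a partial sum far enough out; this uses up the second extra halving.
    S-near-limit : ∀ {y k} → S x ⟶ y → C ℕ.≤ k ℕ.+ slack → S x k ~[ level k ] y
    S-near-limit {y} {k} S⟶y C≤k = let N , near = S⟶y (suc (level k)) in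
      ~-trans (S-tail C≤k (ℕ.m≤n⊔m N k)) (near (ℕ.m≤m⊔n N k))

    S-vanishes : ∀ {k} → S x ⟶ ε → C ℕ.≤ k ℕ.+ slack → S x k ≈ ε
    S-vanishes {k} S⟶ε C≤k =
      basis-separating k x (widened C≤k) (~-sym (S-near-limit S⟶ε C≤k))

  -- The sequence x itself may be unbounded (an arbitrary integer lift of a
  -- sequence of residues); x′ is a bounded sequence with the same sums.
  Vanishing : ℕ → Pred (ℕ → ℤ) ℓ
  Vanishing K x = ∃ λ x′ → Bounded slack x′ × (∀ k → S x k ≈ S x′ k) × S x K ≈ ε

  -- With the bound equal to `slack`, the tail estimate holds from every stage on, in particular
  -- from `K`. Continuity of the embeddings rests on this.
  vanishing⇒small : ∀ {K x y} → Vanishing K x → S x ⟶ y → ε ~[ K ] y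
  vanishing⇒small {K} (x′ , bounded , S≈S′ , SxK≈ε) S⟶y =
    ~-weaken (k≤level K) (~-resp-≈ (≈-trans (≈-sym (S≈S′ K)) SxK≈ε) ≈-refl
      (S-near-limit bounded (⟶-resp-≈ S≈S′ S⟶y) (ℕ.m≤n+m slack K)))

-- The homomorphism given by infinite sums.

BallsInOpens : (A : TopologicalAbelianGroup c ℓ o) →
               Gauge (TopologicalAbelianGroup.abelianGroup A) → Set (lsuc 0ℓ ⊔ c ⊔ o)
BallsInOpens A Γ = ∀ {V} → IsOpen V → ∀ {x} → V x → ∃ λ n → ∀ {y} → x ~[ n ] y → V y
  where
  open Topology (TopologicalAbelianGroup.topology A)
  open Gauge Γ

module Embedding
  (em : ∀ {ℓ′} → ExcludedMiddle ℓ′)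
  (A : TopologicalAbelianGroup c ℓ o) (Γ : Gauge (TopologicalAbelianGroup.abelianGroup A))
  (ball-in-open : BallsInOpens A Γ)
  (slack : ℕ) {g : Level} (policy : TermPolicy Γ g)
  (M : TopologicalAbelianGroup c′ ℓ′ o′)
  where
  private
    module M = TopologicalAbelianGroup M
    module A = TopologicalAbelianGroup A
  open A using (Carrier; _≈_; _∙_; _⁻¹; ε; ∙-cong)
    renaming (refl to ≈-refl; sym to ≈-sym; trans to ≈-trans)
  open IntegerMultiples A.abelianGroup
  open Construction em Γ slack policy
  open Gauge Γ
  open Limits Γ
  open AbelianGroupProperties A.abelianGroup
  open GroupMorphisms M.rawGroup A.rawGroup using (IsGroupMonomorphism)

  -- Addition in the source is addition of integer sequences, hence the strict `π-∙`. Equality and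
  -- boundedness are asked only of the sums, because elements of ℤ/p have many, possibly unbounded,
  -- integer representatives.
  record Coordinates : Set (lsuc 0ℓ ⊔ c ⊔ ℓ ⊔ c′ ⊔ ℓ′ ⊔ o′) where
    field
      π         : M.Carrier → ℕ → ℤ
      π-∙       : ∀ x y k → π (x M.∙ y) k ≡ π x k ℤ.+ π y k
      S-cong    : ∀ {x y} → x M.≈ y → ∀ k → S (π x) k ≈ S (π y) k
      bounded   : ∀ x → ∃₂ λ x′ C → Bounded C x′ × (∀ k → S (π x) k ≈ S x′ k)
      injective : ∀ x → (∃ λ K → ∀ {k} → K ℕ.≤ k → S (π x) k ≈ ε) → x M.≈ M.ε
      isOpen    : ∀ {V} → (∀ {x} → V x → ∃ λ K → ∀ {y} → Vanishing K (π (y M.∙ x M.⁻¹)) → V y) →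
                  Topology.IsOpen M.topology V

  embedding : Coordinates → M ⊑ A
  embedding coordinates = f , isGroupMonomorphism , continuous
    where
    open Coordinates coordinates

    converges : ∀ x → ∃ λ y → S (π x) ⟶ y
    converges x = let x′ , C , b , S≈S′ = bounded x
                      y , conv = limit {C} b in
      y , ⟶-resp-≈ (λ k → ≈-sym (S≈S′ k)) conv

    f : M.Carrier → Carrier
    f x = proj₁ (converges x)

    f-limit : ∀ x → S (π x) ⟶ f x
    f-limit x = proj₂ (converges x)

    f-cong : ∀ {x y} → x M.≈ y → f x ≈ f y
    f-cong {x} {y} x≈y = ⟶-unique (f-limit x) (⟶-resp-≈ (λ k → ≈-sym (S-cong x≈y k)) (f-limit y))

    f-∙ : ∀ x y → f (x M.∙ y) ≈ f x ∙ f y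
    f-∙ x y = ⟶-unique (f-limit (x M.∙ y)) (⟶-resp-≈
      (λ k → ≈-trans (≈-sym (comb-homo-+ (basis k) (π x) (π y)))
                     (comb-cong (basis k) (λ i → sym (π-∙ x y i))))
      (⟶-∙ (f-limit x) (f-limit y)))

    f-ε : f M.ε ≈ ε
    f-ε = ∙-cancelˡ (f M.ε) (f M.ε) ε (≈-trans (≈-sym (f-∙ M.ε M.ε))
      (≈-trans (f-cong (M.identityˡ M.ε)) (≈-sym (A.identityʳ (f M.ε)))))

    f-⁻¹ : ∀ x → f (x M.⁻¹) ≈ f x ⁻¹
    f-⁻¹ x = inverseʳ-unique (f x) (f (x M.⁻¹))
      (≈-trans (≈-sym (f-∙ x (x M.⁻¹))) (≈-trans (f-cong (M.inverseʳ x)) f-ε))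

    f-kernel : ∀ x → f x ≈ ε → x M.≈ M.ε
    f-kernel x fx≈ε =
      let x′ , C , b , S≈S′ = bounded x in
      injective x (C , λ {k} C≤k → ≈-trans (S≈S′ k) (S-vanishes {C} b
        (λ n → let N , near = f-limit x n in N , λ {i} N≤i → ~-resp-≈ (S≈S′ i) fx≈ε (near N≤i))
        (ℕ.≤-trans C≤k (ℕ.m≤m+n k slack))))

    f-injective : ∀ {x y} → f x ≈ f y → x M.≈ y
    f-injective {x} {y} fx≈fy = M-cancel x y (f-kernel (x M.∙ y M.⁻¹)
      (≈-trans (f-∙ x (y M.⁻¹)) (≈-trans (∙-cong fx≈fy (f-⁻¹ y)) (A.inverseʳ (f y)))))
      where open AbelianGroupProperties M.abelianGroup using () renaming (x∙y⁻¹≈ε⇒x≈y to M-cancel)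

    isGroupMonomorphism : IsGroupMonomorphism f
    isGroupMonomorphism = record
      { isGroupHomomorphism = record
        { isMonoidHomomorphism = record
          { isMagmaHomomorphism = record
            { isRelHomomorphism = record { cong = f-cong }
            ; homo = f-∙
            }
          ; ε-homo = f-ε
          }
        ; ⁻¹-homo = f-⁻¹
        }
      ; injective = f-injective
      }

    continuous : Continuous M.topology A.topology f
    continuous {V} V-open = isOpen λ {x} Vfx →
      let n , ball  = ball-in-open V-open Vfx
          -- Without an invariant metric, f y is written as f x + f (y - x), and continuity of
          -- addition at `(f x , ε)` is used.
          K , near = ∙-continuous (f x) ε n in
      K , λ {y} vanishing → ball (~-resp-≈ (A.identityʳ (f x))
        (≈-trans (≈-sym (f-∙ x (y M.∙ x M.⁻¹))) (f-cong (M-xyx⁻¹≈y x y)))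
        (near ~-refl (vanishing⇒small vanishing (f-limit (y M.∙ x M.⁻¹)))))
      where
      M-xyx⁻¹≈y : ∀ x y → x M.∙ (y M.∙ x M.⁻¹) M.≈ y
      M-xyx⁻¹≈y x y = M.trans (M.sym (M.assoc x y (x M.⁻¹)))
        (AbelianGroupProperties.xyx⁻¹≈y M.abelianGroup x y)

-- The two embeddings.

module Cases
  (em : ∀ {ℓ′} → ExcludedMiddle ℓ′)
  (A : TopologicalAbelianGroup c ℓ o) (Γ : Gauge (TopologicalAbelianGroup.abelianGroup A))
  (ball-in-open : BallsInOpens A Γ)
  where
  open TopologicalAbelianGroup A renaming (refl to ≈-refl; sym to ≈-sym; trans to ≈-trans)
    hiding (∙-continuous; ⁻¹-continuous)
  open AbelianGroupProperties abelianGroup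
  open Gauge Γ
  open IntegerMultiples abelianGroup
  open Countability em Γ

  ℓ¹-embeds : Uncountable setoid → (∀ p → Prime p → DiscreteTorsion p) → ℓ¹ℤ ⊑ A
  ℓ¹-embeds uncountable discrete = embedding record
    { π         = proj₁
    ; π-∙       = λ _ _ _ → refl
    ; S-cong    = λ x≈y k → comb-cong (basis k) x≈y
    ; bounded   = λ x → let C , b = coefficient-bound x in proj₁ x , C , b , λ _ → ≈-refl
    ; injective = λ { x (K , h) i →
                    independent (K ℕ.⊔ suc i) (h (ℕ.m≤m⊔n K (suc i))) (ℕ.m≤n⊔m K (suc i)) }
    ; isOpen    = λ h {x} Vx → let K , s = h Vx in
                    1/! K , 1/!>0 K , λ {y} near →
                      s (close⇒vanishing K (y ℓ¹.∙ x ℓ¹.⁻¹) (proj₂ (d-sym x y) near))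
    }
    where
    policy : TermPolicy Γ ℓ
    policy = record
      { Good = λ v a → ∀ m → Span v (m · a) → m ≡ ℤ.0ℤ
      ; good = small-independent uncountable discrete
      }

    open Construction em Γ 1 policy
    open Embedding em A Γ ball-in-open 1 policy ℓ¹ℤ
    open Metric ℓ¹-metric using (d-sym)

    -- If the sum vanishes, the negated last summand is a multiple of `term k` lying in the span of
    -- its predecessors.
    last-coefficient : ∀ x k → S x (suc k) ≈ ε → x k ≡ ℤ.0ℤ
    last-coefficient x k S≈ε = ℤ.neg-injective (term-good k (ℤ.- x k) (x ,
      ≈-trans (·-homo-neg (x k) (term k)) (≈-sym (inverseˡ-unique (S x k) (x k · term k) S≈ε))))

    independent : ∀ {x} k → S x k ≈ ε → ∀ {i} → i ℕ.< k → x i ≡ ℤ.0ℤ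
    independent {x} (suc k) S≈ε i<1+k
      with last≡0 ← last-coefficient x k S≈ε | ℕ.m≤n⇒m<n∨m≡n (ℕ.s≤s⁻¹ i<1+k)
    ... | inj₂ refl = last≡0
    ... | inj₁ i<k  = independent k (≈-trans (≈-sym (identityʳ _))
      (≈-trans (∙-congˡ (·-congˡ (term k) (sym last≡0))) S≈ε)) i<k

    coefficient-bound : ∀ x → ∃ λ C → Bounded C (proj₁ x)
    coefficient-bound x =
      let q , ∥x∥<q = ℝ.inhabited ∥ x ∥₁
          C , q≤C = ceiling q in
      C , λ k → ℕ.<⇒≤ (subst (ℕ._< C ℕ.* k !) (ℕ.*-identityʳ ∣ proj₁ x k ∣)
        (/-drop-< ∣ proj₁ x k ∣ C (k !) 1 {{k ℕ.!≢0}} (ℚ.<-≤-trans (weight-≤-norm x k ∥x∥<q) q≤C)))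

    1/! : ℕ → ℚ.ℚ
    1/! K = (ℤ.+ 1 ℚ./ K !) {{K ℕ.!≢0}}

    1/!>0 : ∀ K → ℚ.0ℚ ℚ.< 1/! K
    1/!>0 K = ℚ.positive⁻¹ _ {{ℚ.normalize-pos 1 (K !) {{K ℕ.!≢0}}}}

    -- Each ∣xₖ∣/k! is below 1/K!. For k < K this forces the integer xₖ to be 0, and in general it
    -- gives ∣xₖ∣ ≤ k!, which is why the slack is 1.
    close⇒vanishing : ∀ K z → ∥ z ∥₁ <ℚ 1/! K → Vanishing K (proj₁ z)
    close⇒vanishing K z@(x , _) small =
      x ,
      (λ k → ℕ.≤-trans (ℕ.m≤m*n ∣ x k ∣ (K !) {{K ℕ.!≢0}}) (ℕ.<⇒≤ (bound k))) ,
      (λ _ → ≈-refl) ,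
      S-zero K λ {i} i<K → ·-congˡ (term i) (zero-below i<K)
      where
      bound : ∀ k → ∣ x k ∣ ℕ.* K ! ℕ.< 1 ℕ.* k !
      bound k = /-drop-< ∣ x k ∣ 1 (k !) (K !) {{k ℕ.!≢0}} {{K ℕ.!≢0}} (weight-≤-norm z k small)

      !-mono : ∀ {i k} → i ℕ.≤′ k → i ! ℕ.≤ k !
      !-mono ℕ.≤′-refl = ℕ.≤-refl
      !-mono (ℕ.≤′-step {k} i≤k) = ℕ.≤-trans (!-mono i≤k) (ℕ.m≤n*m (k !) (suc k))

      zero-below : ∀ {i} → i ℕ.< K → x i ≡ ℤ.0ℤ
      zero-below {i} i<K = ℤ.∣i∣≡0⇒i≡0 (ℕ.n<1⇒n≡0 (ℕ.*-cancelʳ-< (K !) ∣ x i ∣ 1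
        (ℕ.<-≤-trans (bound i) (ℕ.*-monoʳ-≤ 1 (!-mono (ℕ.≤⇒≤′ (ℕ.<⇒≤ i<K)))))))

  [ℤ/p]^ℕ-embeds : ∀ {p} → Prime p → ¬ DiscreteTorsion p → [ℤ/ p ℤ]^ℕ ⊑ A
  [ℤ/p]^ℕ-embeds {p} p-prime ¬discrete = embedding record
    { π         = λ x → x
    ; π-∙       = λ _ _ _ → refl
    ; S-cong    = S-mod
    ; bounded   = λ x → residue x , p , residue-bounded x , S≈S-residue x
    ; injective = λ { x (K , h) i → let k = K ℕ.⊔ suc i in
                    ≡0⇒∣ (x i) (independent x k (≈-trans (≈-sym (S≈S-residue x k)) (h (ℕ.m≤m⊔n K (suc i))))
                                              (ℕ.m≤n⊔m K (suc i))) }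
    ; isOpen    = λ h {x} Vx → let K , s = h Vx in
                    -- The box fixing the first `K` residues of `x`; on it the first `K` summands of
                    -- the difference vanish.
                    K , (λ k i → i ℤ/p.≈ x k) ,
                    (λ k {i} {j} i≈j i≈x → ℤ/p.trans {j} {i} {x k} (ℤ/p.sym {i} {j} i≈j) i≈x) ,
                    (λ k _ → ℤ/p.refl {x k}) ,
                    λ {y} near → let z = λ k → y k ℤ.- x k in
                      s (residue z , residue-bounded z , S≈S-residue z ,
                         S-zero K λ {i} i<K → zero-mod (near i i<K) i)
    }
    where
    instance _ = prime⇒nonZero p-prime
    module ℤ/p = AbelianGroup (ℤ/ p ℤ)

    policy : TermPolicy Γ ℓ
    policy = record
      { Good = λ _ a → ¬ a ≈ ε × ℤ.+ p · a ≈ ε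
      -- If no such element existed within `n` of 0, then `n` would witness discreteness of A[p].
      ; good = λ _ n → decidable-stable em λ none → ¬discrete
          (n , λ px≈ε near → decidable-stable em λ x≉ε → none (_ , near , x≉ε , px≈ε))
      }

    open Construction em Γ p policy
    open Embedding em A Γ ball-in-open p policy [ℤ/ p ℤ]^ℕ

    S-mod : ∀ {x y} → (∀ k → ℤ.+ p ∣ℤ x k ℤ.- y k) → ∀ k → S x k ≈ S y k
    S-mod h zero    = ≈-refl
    S-mod {x} {y} h (suc k) = ∙-cong (S-mod h k) (·-mod (proj₂ (term-good k)) {x k} {y k} (h k))

    zero-mod : ∀ {m} → ℤ.+ p ∣ℤ m → ∀ i → m · term i ≈ ε
    zero-mod (divides q eq) i = ≈-trans (·-congˡ (term i) eq) (·-multiple q p (proj₂ (term-good i)))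

    -- The lift to 0, ..., p - 1 is bounded and has the same sums, since every term lies in A[p].
    residue : (ℕ → ℤ) → ℕ → ℤ
    residue x k = ℤ.+ (x k %ℕ p)

    x≡residue : ∀ x k → ℤ.+ p ∣ℤ x k ℤ.- residue x k
    x≡residue x k = divides (x k /ℕ p) (trans (cong (ℤ._- residue x k) (a≡a%ℕn+[a/ℕn]*n (x k) p))
                      (lemma (residue x k) (x k /ℕ p ℤ.* ℤ.+ p)))
      where
      lemma : ∀ r q → (r ℤ.+ q) ℤ.- r ≡ q
      lemma = solve 2 (λ r q → (r :+ q) :- r := q) refl
        where open +-*-Solver

    S≈S-residue : ∀ x k → S x k ≈ S (residue x) k
    S≈S-residue x = S-mod {x} {residue x} (x≡residue x)

    residue-bounded : ∀ x → Bounded p (residue x)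
    residue-bounded x k = ℕ.≤-trans (ℕ.<⇒≤ (n%ℕd<d (x k) p)) (ℕ.m≤m*n p (k !) {{k ℕ.!≢0}})

    ≡0⇒∣ : ∀ m → ℤ.+ (m %ℕ p) ≡ ℤ.0ℤ → ℤ.+ p ∣ℤ m ℤ.- ℤ.0ℤ
    ≡0⇒∣ m eq = subst (λ r → ℤ.+ p ∣ℤ m ℤ.- r) eq (x≡residue (λ _ → m) 0)

    no-annihilator : ∀ r → r ℕ.< p → ∀ {a} → ¬ a ≈ ε → ℤ.+ p · a ≈ ε → ℤ.+ r · a ≈ ε → r ≡ 0
    no-annihilator zero    _   _   _    _    = refl
    no-annihilator (suc r) r<p a≉ε pa≈ε ra≈ε =
      contradiction (coprime-annihilators (prime⇒coprime p-prime r<p) pa≈ε ra≈ε) a≉ε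

    -- Separation supplies the independence here: it makes the prefix vanish, so the last residue
    -- annihilates a nonzero element of A[p]. A residue below p that does so is 0, as otherwise it
    -- would be coprime to p.
    independent : ∀ x k → S (residue x) k ≈ ε → ∀ {i} → i ℕ.< k → residue x i ≡ ℤ.0ℤ
    independent x (suc k) S≈ε i<1+k
      with prefix≈ε ← S-prefix-vanishes {p} {residue x} (residue-bounded x) (ℕ.m≤n+m p k) S≈ε
         | ℕ.m≤n⇒m<n∨m≡n (ℕ.s≤s⁻¹ i<1+k)
    ... | inj₁ i<k  = independent x k prefix≈ε i<k
    ... | inj₂ refl = cong ℤ.+_ (no-annihilator _ (n%ℕd<d (x k) p) (proj₁ (term-good k))
      (proj₂ (term-good k)) (≈-trans (≈-sym (identityˡ _)) (≈-trans (∙-congʳ (≈-sym prefix≈ε)) S≈ε)))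

theorem4p2 : (∀ {ℓ′} → ExcludedMiddle ℓ′) →
    ∀ {c ℓ o : Level} (A : AbelianPolishGroup c ℓ o) →
    let open AbelianPolishGroup A in
    Uncountable setoid →
    ℓ¹ℤ ⊑ topologicalAbelianGroup ⊎
    (∃ λ p → Prime p × [ℤ/ p ℤ]^ℕ ⊑ topologicalAbelianGroup)
theorem4p2 em A uncountable = dichotomy em
  where
  open AbelianPolishGroup A using (topologicalAbelianGroup)
  open FromMetric A using (gauge; ball-in-open)
  open Countability em gauge using (DiscreteTorsion)
  open Cases em topologicalAbelianGroup gauge ball-in-open

  dichotomy : Dec (∃ λ p → Prime p × ¬ DiscreteTorsion p) →
              ℓ¹ℤ ⊑ topologicalAbelianGroup ⊎
              (∃ λ p → Prime p × [ℤ/ p ℤ]^ℕ ⊑ topologicalAbelianGroup)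
  dichotomy (yes (p , p-prime , ¬discrete)) = inj₂ (p , p-prime , [ℤ/p]^ℕ-embeds p-prime ¬discrete)
  dichotomy (no none) = inj₁ (ℓ¹-embeds uncountable λ p p-prime →
    decidable-stable em λ ¬discrete → none (p , p-prime , ¬discrete))
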